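{- For every integer $r\ge1$ and every $n\ge1$, as an identity of polynomials in $t$, $$\ddot H_n\Bigl(\frac{1}{(\cos x-t\sin x)^{r}}\Bigr) =\bigl(t(t^2+1)\bigr)^{\binom n2}\, \ddot H_n\Bigl(\frac{1}{(1-x)^{r}}\Bigr).$$
   Context: For a formal power series $f(x)=\sum_{k\ge0}a_kx^k/k!$ in $x$, the dilated Hankel determinant is $\ddot H_n(f)=\det(a_{2i+j})_{0\le i,j\le n-1}$. Here $t$ is a parameter (indeterminate) on which the coefficients $a_k$ depend polynomially. -}

module Defs where

open import Algebra.Bundles using (CommutativeRing; CommutativeSemigroup; RawRing)
open import Algebra.Structures using (IsAbelianGroup; IsCommutativeRing)
open import Data.Fin.Base using (Fin; zero; suc; toℕ)
open import Data.Integer.Base as ℤ using (ℤ)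
open import Data.List.Base using (List; []; _∷_; map)
open import Data.Nat.Base as ℕ using (ℕ; zero; suc; _∸_; _!)
open import Data.Nat.Properties using (_!≢0)
open import Data.Product.Base using (_,_)
import Data.Rational.Base as ℚ
import Data.Rational.Properties as ℚ
open import Data.Vec.Functional as Vector using (Vector; head; tail; removeAt)
open import Function.Base using (_∘_)
open import Relation.Binary.PropositionalEquality.Core as ≡ using (_≡_)
import Algebra.Definitions.RawSemiring
import Algebra.Properties.AbelianGroup
import Algebra.Properties.CommutativeSemigroup
import Algebra.Properties.Semiring.Sum

-- A polynomial is its list of coefficients, constant term first. Lists
-- differing by trailing zeros are the same polynomial, so equality is
-- coefficientwise.

module Polynomial {c ℓ} (R : CommutativeRing c ℓ) where

  open CommutativeRing R hiding (zero)

  Poly : Set c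
  Poly = List Carrier

  coeff : Poly → ℕ → Carrier
  coeff []      _       = 0#
  coeff (a ∷ p) zero    = a
  coeff (a ∷ p) (suc k) = coeff p k

  infix 4 _≋_
  record _≋_ (p q : Poly) : Set ℓ where
    constructor mk≋
    field coeff≈ : ∀ k → coeff p k ≈ coeff q k
  open _≋_ public

  infixl 6 _⊕_
  infixl 7 _⊗_ _·_
  infix  8 ⊝_

  _⊕_ : Poly → Poly → Poly
  []      ⊕ q       = q
  (a ∷ p) ⊕ []      = a ∷ p
  (a ∷ p) ⊕ (b ∷ q) = a + b ∷ p ⊕ q

  ⊝_ : Poly → Poly
  ⊝_ = map (-_)

  _·_ : Carrier → Poly → Poly
  a · p = map (a *_) p

  _⊗_ : Poly → Poly → Poly
  []      ⊗ q = []
  (a ∷ p) ⊗ q = a · q ⊕ (0# ∷ p ⊗ q)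

  constant : Carrier → Poly
  constant a = a ∷ []

  variable-t : Poly
  variable-t = 0# ∷ 1# ∷ []

  private
    module AG = Algebra.Properties.AbelianGroup +-abelianGroup

    coeff-⊕ : ∀ p q k → coeff (p ⊕ q) k ≈ coeff p k + coeff q k
    coeff-⊕ []      q       k       = sym (+-identityˡ _)
    coeff-⊕ (a ∷ p) []      k       = sym (+-identityʳ _)
    coeff-⊕ (a ∷ p) (b ∷ q) zero    = refl
    coeff-⊕ (a ∷ p) (b ∷ q) (suc k) = coeff-⊕ p q k

    coeff-⊝ : ∀ p k → coeff (⊝ p) k ≈ - coeff p k
    coeff-⊝ []      k       = sym AG.ε⁻¹≈ε
    coeff-⊝ (a ∷ p) zero    = refl
    coeff-⊝ (a ∷ p) (suc k) = coeff-⊝ p k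

    coeff-· : ∀ a p k → coeff (a · p) k ≈ a * coeff p k
    coeff-· a []      k       = sym (zeroʳ a)
    coeff-· a (b ∷ p) zero    = refl
    coeff-· a (b ∷ p) (suc k) = coeff-· a p k

    ⊕-cong : ∀ {p p′ q q′} → p ≋ p′ → q ≋ q′ → p ⊕ q ≋ p′ ⊕ q′
    ⊕-cong {p} {p′} {q} {q′} e f = mk≋ λ k →
      trans (coeff-⊕ p q k)
        (trans (+-cong (coeff≈ e k) (coeff≈ f k)) (sym (coeff-⊕ p′ q′ k)))

    ⊕-isAbelianGroup : IsAbelianGroup _≋_ _⊕_ [] ⊝_
    ⊕-isAbelianGroup = record
      { isGroup = record
        { isMonoid = record
          { isSemigroup = record
            { isMagma = record
              { isEquivalence = record
                { refl  = mk≋ λ _ → refl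
                ; sym   = λ e → mk≋ λ k → sym (coeff≈ e k)
                ; trans = λ e f → mk≋ λ k → trans (coeff≈ e k) (coeff≈ f k)
                }
              ; ∙-cong = ⊕-cong
              }
            ; assoc = λ p q r → mk≋ λ k →
                trans (coeff-⊕ (p ⊕ q) r k)
                (trans (+-congʳ (coeff-⊕ p q k))
                (trans (+-assoc _ _ _)
                (trans (+-congˡ (sym (coeff-⊕ q r k)))
                       (sym (coeff-⊕ p (q ⊕ r) k)))))
            }
          ; identity = (λ p → mk≋ λ k → trans (coeff-⊕ [] p k) (+-identityˡ _))
                     , (λ p → mk≋ λ k → trans (coeff-⊕ p [] k) (+-identityʳ _))
          }
        ; inverse =
            (λ p → mk≋ λ k → trans (coeff-⊕ (⊝ p) p k)
                     (trans (+-congʳ (coeff-⊝ p k)) (-‿inverseˡ _)))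
          , (λ p → mk≋ λ k → trans (coeff-⊕ p (⊝ p) k)
                     (trans (+-congˡ (coeff-⊝ p k)) (-‿inverseʳ _)))
        ; ⁻¹-cong = λ {p} {q} e → mk≋ λ k →
            trans (coeff-⊝ p k) (trans (-‿cong (coeff≈ e k)) (sym (coeff-⊝ q k)))
        }
      ; comm = λ p q → mk≋ λ k →
          trans (coeff-⊕ p q k) (trans (+-comm _ _) (sym (coeff-⊕ q p k)))
      }

    module P = IsAbelianGroup ⊕-isAbelianGroup

    ⊕-commutativeSemigroup : CommutativeSemigroup c ℓ
    ⊕-commutativeSemigroup =
      record { isCommutativeSemigroup = P.isCommutativeSemigroup }

    module CS = Algebra.Properties.CommutativeSemigroup ⊕-commutativeSemigroup

    ∷-cong : ∀ {a b p q} → a ≈ b → p ≋ q → (a ∷ p) ≋ (b ∷ q)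
    ∷-cong e f = mk≋ λ { zero → e ; (suc k) → coeff≈ f k }

    ∷-≋[] : ∀ {a p} → a ≈ 0# → p ≋ [] → (a ∷ p) ≋ []
    ∷-≋[] e f = mk≋ λ { zero → e ; (suc k) → coeff≈ f k }

    ·-cong : ∀ {a b p q} → a ≈ b → p ≋ q → a · p ≋ b · q
    ·-cong {a} {b} {p} {q} e f = mk≋ λ k →
      trans (coeff-· a p k) (trans (*-cong e (coeff≈ f k)) (sym (coeff-· b q k)))

    0·≋[] : ∀ {a} → a ≈ 0# → ∀ p → a · p ≋ []
    0·≋[] e p = mk≋ λ k → trans (coeff-· _ p k) (trans (*-congʳ e) (zeroˡ _))

    ·-distribʳ : ∀ a b p → (a + b) · p ≋ a · p ⊕ b · p
    ·-distribʳ a b p = mk≋ λ k →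
      trans (coeff-· (a + b) p k)
      (trans (distribʳ _ a b)
      (trans (sym (+-cong (coeff-· a p k) (coeff-· b p k)))
             (sym (coeff-⊕ (a · p) (b · p) k))))

    ·-distribˡ : ∀ a p q → a · (p ⊕ q) ≋ a · p ⊕ a · q
    ·-distribˡ a p q = mk≋ λ k →
      trans (coeff-· a (p ⊕ q) k)
      (trans (*-congˡ (coeff-⊕ p q k))
      (trans (distribˡ a _ _)
      (trans (sym (+-cong (coeff-· a p k) (coeff-· a q k)))
             (sym (coeff-⊕ (a · p) (a · q) k)))))

    ·-assoc : ∀ a b p → (a * b) · p ≋ a · (b · p)
    ·-assoc a b p = mk≋ λ k →
      trans (coeff-· (a * b) p k)
      (trans (*-assoc a b _)
      (trans (*-congˡ (sym (coeff-· b p k))) (sym (coeff-· a (b · p) k))))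

    shift-⊕ : ∀ p q → (0# ∷ p ⊕ q) ≋ (0# ∷ p) ⊕ (0# ∷ q)
    shift-⊕ p q = ∷-cong (sym (+-identityˡ 0#)) P.refl

    ≋[]-⊗ : ∀ p q → p ≋ [] → p ⊗ q ≋ []
    ≋[]-⊗ []      q e = P.refl
    ≋[]-⊗ (a ∷ p) q e = ⊕-cong (0·≋[] (coeff≈ e 0) q)
      (∷-≋[] refl (≋[]-⊗ p q (mk≋ (coeff≈ e ∘ suc))))

    ⊗-congʳ : ∀ p p′ q → p ≋ p′ → p ⊗ q ≋ p′ ⊗ q
    ⊗-congʳ []      p′       q e = P.sym (≋[]-⊗ p′ q (P.sym e))
    ⊗-congʳ (a ∷ p) []       q e = ≋[]-⊗ (a ∷ p) q e
    ⊗-congʳ (a ∷ p) (b ∷ p′) q e = ⊕-cong (·-cong (coeff≈ e 0) (P.refl {q}))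
      (∷-cong refl (⊗-congʳ p p′ q (mk≋ (coeff≈ e ∘ suc))))

    ⊗-congˡ : ∀ p {q q′} → q ≋ q′ → p ⊗ q ≋ p ⊗ q′
    ⊗-congˡ []      e = P.refl
    ⊗-congˡ (a ∷ p) e = ⊕-cong (·-cong refl e) (∷-cong refl (⊗-congˡ p e))

    ⊗-distribʳ : ∀ r p q → (p ⊕ q) ⊗ r ≋ p ⊗ r ⊕ q ⊗ r
    ⊗-distribʳ r []      q       = P.refl
    ⊗-distribʳ r (a ∷ p) []      = P.sym (P.identityʳ _)
    ⊗-distribʳ r (a ∷ p) (b ∷ q) = P.trans
      (⊕-cong (·-distribʳ a b r)
        (P.trans (∷-cong refl (⊗-distribʳ r p q)) (shift-⊕ (p ⊗ r) (q ⊗ r))))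
      (CS.interchange (a · r) (b · r) _ _)

    ⊗-zeroʳ : ∀ p → p ⊗ [] ≋ []
    ⊗-zeroʳ []      = P.refl
    ⊗-zeroʳ (a ∷ p) = ∷-≋[] refl (⊗-zeroʳ p)

    ⊗-∷ : ∀ p b q → p ⊗ (b ∷ q) ≋ b · p ⊕ (0# ∷ p ⊗ q)
    ⊗-∷ []      b q = P.sym (∷-≋[] refl P.refl)
    ⊗-∷ (a ∷ p) b q = ∷-cong (+-congʳ (*-comm a b))
      (P.trans (⊕-cong (P.refl {a · q}) (⊗-∷ p b q)) (CS.x∙yz≈y∙xz (a · q) (b · p) (0# ∷ p ⊗ q)))

    ⊗-comm : ∀ p q → p ⊗ q ≋ q ⊗ p
    ⊗-comm p []      = ⊗-zeroʳ p
    ⊗-comm p (b ∷ q) = P.trans (⊗-∷ p b q)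
      (⊕-cong (P.refl {b · p}) (∷-cong refl (⊗-comm p q)))

    ·-⊗ : ∀ a p q → (a · p) ⊗ q ≋ a · (p ⊗ q)
    ·-⊗ a []      q = P.refl
    ·-⊗ a (b ∷ p) q = P.trans
      (⊕-cong (·-assoc a b q) (∷-cong (sym (zeroʳ a)) (·-⊗ a p q)))
      (P.sym (·-distribˡ a (b · q) (0# ∷ p ⊗ q)))

    ⊗-assoc : ∀ p q r → (p ⊗ q) ⊗ r ≋ p ⊗ (q ⊗ r)
    ⊗-assoc []      q r = P.refl
    ⊗-assoc (a ∷ p) q r = P.trans (⊗-distribʳ r (a · q) (0# ∷ p ⊗ q))
      (⊕-cong (·-⊗ a q r)
        (⊕-cong (0·≋[] refl r) (∷-cong refl (⊗-assoc p q r))))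

    ⊗-identityˡ : ∀ p → constant 1# ⊗ p ≋ p
    ⊗-identityˡ p = P.trans
      (⊕-cong (mk≋ λ k → trans (coeff-· 1# p k) (*-identityˡ _)) (∷-≋[] refl P.refl))
      (P.identityʳ p)

  polyIsCommutativeRing : IsCommutativeRing _≋_ _⊕_ _⊗_ ⊝_ [] (constant 1#)
  polyIsCommutativeRing = record
    { isRing = record
      { +-isAbelianGroup = ⊕-isAbelianGroup
      ; *-cong     = λ {p} {p′} {q} {q′} e f →
          P.trans (⊗-congʳ p p′ q e) (⊗-congˡ p′ f)
      ; *-assoc    = ⊗-assoc
      ; *-identity = ⊗-identityˡ
                   , (λ p → P.trans (⊗-comm p _) (⊗-identityˡ p))
      ; distrib    = (λ r p q → P.trans (⊗-comm r (p ⊕ q))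
                       (P.trans (⊗-distribʳ r p q) (⊕-cong (⊗-comm p r) (⊗-comm q r))))
                   , ⊗-distribʳ
      }
    ; *-comm = ⊗-comm
    }

  polyRing : CommutativeRing c ℓ
  polyRing = record { isCommutativeRing = polyIsCommutativeRing }

module Determinant {c ℓ} (R : CommutativeRing c ℓ) where

  open CommutativeRing R hiding (zero)
  open Algebra.Definitions.RawSemiring (RawRing.rawSemiring rawRing)

  -- Laplace expansion along the first row.

  det : ∀ n → Vector (Vector Carrier n) n → Carrier
  det zero    A = 1#
  det (suc n) A =
    sum λ j → (- 1#) ^ toℕ j * (head A j * det n (λ i → removeAt (tail A i) j))

-- f k is the ordinary coefficient of x^k.

module PowerSeries {c ℓ} (R : CommutativeRing c ℓ) where

  open CommutativeRing R hiding (zero)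
  open Algebra.Definitions.RawSemiring (RawRing.rawSemiring rawRing)
  open Determinant R

  Series : Set c
  Series = ℕ → Carrier

  infix  4 _≈ₛ_
  infixl 6 _+ₛ_ _-ₛ_
  infixl 7 _*ₛ_
  infix  8 -ₛ_
  infix  8 1/_

  record _≈ₛ_ (f g : Series) : Set ℓ where
    constructor mk≈ₛ
    field at : ∀ k → f k ≈ g k
  open _≈ₛ_ public

  scalar : Carrier → Series
  scalar a zero    = a
  scalar a (suc _) = 0#

  0ₛ 1ₛ x : Series
  0ₛ = scalar 0#
  1ₛ = scalar 1#
  x zero    = 0#
  x (suc k) = 1ₛ k

  -ₛ_ : Series → Series
  (-ₛ f) k = - f k

  _+ₛ_ _-ₛ_ _*ₛ_ : Series → Series → Series
  (f +ₛ g) k = f k + g k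
  (f -ₛ g) k = f k - g k
  (f *ₛ g) k = sum {suc k} λ i → f (toℕ i) * g (k ∸ toℕ i)

  seriesRawRing : RawRing c ℓ
  seriesRawRing = record
    { _≈_ = _≈ₛ_ ; _+_ = _+ₛ_ ; _*_ = _*ₛ_ ; -_ = -ₛ_ ; 0# = 0ₛ ; 1# = 1ₛ }

  open Algebra.Definitions.RawSemiring (RawRing.rawSemiring seriesRawRing) public
    using () renaming (_^_ to _^ₛ_)

  -- recipPrefix g n lists the coefficients of 1/g from x^n down to x^0, for
  -- a series g with constant term 1: the constant term of 1/g is 1, and the
  -- coefficient of x^{n+1} is − Σ_{i=0}^{n} g_{i+1} (1/g)_{n−i}.

  recipPrefix : Series → ∀ n → Vector Carrier (suc n)
  recipPrefix g zero    = 1# Vector.∷ Vector.[]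
  recipPrefix g (suc n) =
    (- sum λ i → g (suc (toℕ i)) * recipPrefix g n i) Vector.∷ recipPrefix g n

  -- Meaningful only when the constant term of g is 1; see *-recip.

  1/_ : Series → Series
  (1/ g) n = head (recipPrefix g n)

  private
    recipPrefix-lookup : ∀ g n i → recipPrefix g n i ≡ (1/ g) (n ∸ toℕ i)
    recipPrefix-lookup g zero    zero    = ≡.refl
    recipPrefix-lookup g (suc n) zero    = ≡.refl
    recipPrefix-lookup g (suc n) (suc i) = recipPrefix-lookup g n i

    module Sum = Algebra.Properties.Semiring.Sum semiring

  *-recip : ∀ g → g 0 ≈ 1# → g *ₛ 1/ g ≈ₛ 1ₛ
  *-recip g g₀≈1 = mk≈ₛ λ
    { zero    → trans (+-identityʳ _) (trans (*-identityʳ _) g₀≈1)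
    ; (suc n) → trans
        (+-cong (trans (*-congʳ g₀≈1) (*-identityˡ _))
                (Sum.sum-cong-≋ λ i →
                  *-congˡ {g (suc (toℕ i))} (reflexive (≡.sym (recipPrefix-lookup g n i)))))
        (-‿inverseˡ _)
    }

  ^ₛ-constantTerm : ∀ g → g 0 ≈ 1# → ∀ r → (g ^ₛ r) 0 ≈ 1#
  ^ₛ-constantTerm g g₀≈1 zero    = refl
  ^ₛ-constantTerm g g₀≈1 (suc r) = trans (+-identityʳ _)
    (trans (*-cong g₀≈1 (^ₛ-constantTerm g g₀≈1 r)) (*-identityˡ 1#))

  -- The a_k with f = Σ a_k x^k / k!.

  egfCoeff : Series → ℕ → Carrier
  egfCoeff f k = (k !) × f k

  Ḧ : ℕ → Series → Carrier
  Ḧ n f = det n λ i j → egfCoeff f (2 ℕ.* toℕ i ℕ.+ toℕ j)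

open Polynomial ℚ.+-*-commutativeRing public
  using (Poly; coeff; _≋_; constant) renaming (polyRing to ℚ[t]; variable-t to t)

open CommutativeRing ℚ[t] public using (_≈_; _+_; _*_; 1#)

open Algebra.Definitions.RawSemiring (RawRing.rawSemiring (CommutativeRing.rawRing ℚ[t])) public
  using (_^_)

open PowerSeries ℚ[t] public

cos⁽_⁾0 sin⁽_⁾0 : ℕ → ℤ
cos⁽ 0 ⁾0           = ℤ.1ℤ
cos⁽ 1 ⁾0           = ℤ.0ℤ
cos⁽ suc (suc k) ⁾0 = ℤ.- cos⁽ k ⁾0
sin⁽ 0 ⁾0           = ℤ.0ℤ
sin⁽ 1 ⁾0           = ℤ.1ℤ
sin⁽ suc (suc k) ⁾0 = ℤ.- sin⁽ k ⁾0

cosx sinx : Series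
cosx k = constant ((cos⁽ k ⁾0 ℚ./ (k !)) {{k !≢0}})
sinx k = constant ((sin⁽ k ⁾0 ℚ./ (k !)) {{k !≢0}})

private
  constantTerm-cosx-tsinx : (cosx -ₛ scalar t *ₛ sinx) 0 ≈ 1#
  constantTerm-cosx-tsinx = Polynomial.mk≋
    λ { 0 → ≡.refl ; 1 → ≡.refl ; (suc (suc _)) → ≡.refl }

  constantTerm-1-x : (1ₛ -ₛ x) 0 ≈ 1#
  constantTerm-1-x = Polynomial.mk≋ λ { 0 → ≡.refl ; (suc _) → ≡.refl }

-- Both series have constant term 1, so 1/_ does invert their powers.

recip-cosx-tsinx : ∀ r → let g = (cosx -ₛ scalar t *ₛ sinx) ^ₛ r in g *ₛ 1/ g ≈ₛ 1ₛ
recip-cosx-tsinx r = *-recip ((cosx -ₛ scalar t *ₛ sinx) ^ₛ r)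
  (^ₛ-constantTerm (cosx -ₛ scalar t *ₛ sinx) constantTerm-cosx-tsinx r)

recip-1-x : ∀ r → let g = (1ₛ -ₛ x) ^ₛ r in g *ₛ 1/ g ≈ₛ 1ₛ
recip-1-x r = *-recip ((1ₛ -ₛ x) ^ₛ r) (^ₛ-constantTerm (1ₛ -ₛ x) constantTerm-1-x r)

{-# OPTIONS --safe #-}

-- For h = cos x − t sin x and S_l = (sin x)^l / h^(r+l) one has
--   S_l′ = l S_(l−1) + (r + 2l) t S_l + (r + l)(1 + t²) S_(l+1).
-- After scaling S_l, the derivatives at 0 are thus iterates of a tridiagonal
-- operator A started at δ₀. Multiplying a_k by t^k, the columns of (a_(2i+j)) are
-- unitriangular combinations of those of (A^(2i) δ₀)_j. The sequences
--   μ_q(l) = (1 + t²)^l t^(2q) q(q−1)⋯(q−l+1) · r(r+1)⋯(r+q−1)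
-- satisfy A μ_q = μ_(q+1) + c_q μ_(q−1), so the rows A^(2i) δ₀ are unitriangular
-- combinations of the μ_(2k), k ≤ i. In det (μ_(2i)(j)) the powers of t and of
-- 1 + t² split off, and what is left is, by unitriangular column operations
-- again, the determinant of the rising factorials r(r+1)⋯(r+2i+j−1), which are
-- the coefficients of (1 − x)^(−r).

module Submission where

open import Algebra.Bundles using (CommutativeRing; RawRing)
open import Algebra.Structures using (IsCommutativeRing)
open import Data.Empty using (⊥-elim)
open import Data.Fin.Base using (Fin; zero; suc; toℕ; fromℕ<; punchIn)
open import Data.Fin.Properties using (toℕ<n; toℕ-fromℕ<; toℕ-injective; suc-injective)
  renaming (_≟_ to _≟ᶠ_)
open import Data.Integer.Base as ℤ using (ℤ)
import Data.Integer.Properties as ℤ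
import Data.Integer.Tactic.RingSolver as ℤ-Solver
open import Data.List.Base using ([]; _∷_)
open import Data.Nat.Base as ℕ using (ℕ; zero; suc; _<_; _≤_; _≥_; z≤n; s≤s; _!; NonZero)
open import Data.Nat.Combinatorics using (_C_; nC1≡n; nCk+nC[k+1]≡[n+1]C[k+1])
import Data.Nat.Properties as ℕ
open import Data.Product.Base using (_,_; ∃-syntax) renaming (_×_ to _∧_)
import Data.Rational.Base as ℚ
import Data.Rational.Properties as ℚ
import Data.Rational.Unnormalised.Base as ℚᵘ
import Data.Rational.Unnormalised.Properties as ℚᵘ
open import Data.Vec.Functional using (Vector; head; tail; removeAt; updateAt)
open import Data.Vec.Functional.Properties using (updateAt-updates; updateAt-minimal)
open import Function.Base using (_∘_; const)
open import Level using (_⊔_)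
open import Relation.Binary.PropositionalEquality.Core as ≡ using (_≡_; _≢_)
open import Relation.Nullary.Decidable using (yes; no)
import Algebra.Definitions.RawSemiring
import Algebra.Properties.AbelianGroup
import Algebra.Properties.CommutativeMonoid.Mult
import Algebra.Properties.CommutativeMonoid.Sum
import Algebra.Properties.CommutativeSemiring.Exp
import Algebra.Properties.Monoid.Mult
import Algebra.Properties.Ring
import Algebra.Properties.Semiring.Exp
import Algebra.Properties.Semiring.Mult
import Algebra.Properties.Semiring.Sum
import Algebra.Solver.Ring.NaturalCoefficients.Default
import Relation.Binary.Reasoning.Setoid
open import Defs using (module Determinant; module Polynomial; module PowerSeries)

-- The dilation doubles only the row index, so rows and columns behave differently. A column can be
-- cleared with all columns before it, but the rows advance by two steps of A and only even-numbered
-- vectors are at hand to clear them. This succeeds because A μ_q contains no multiple of μ_q: each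
-- application of A switches the parity of q, and A² preserves it. The μ_q come from reading a
-- sequence as an exponential generating function in z. There A is a first-order differential
-- operator with a quadratic leading coefficient, and the substitution w = 1 + (1 + t²) z removes
-- the linear term of that quadratic; μ_q is a constant times w^q. Nothing is divided by t. With N =
-- C(n, 2), weighting a_k by t^k costs t^(3N) on one side, while the μ_q supply t^(4N) (1 + t²)^N on
-- the other; since t is not a zero divisor, (t (1 + t²))^N is left.

-- Unitriangular combinations of a sequence of vectors.

module Span {c ℓ} (R : CommutativeRing c ℓ) where

  open CommutativeRing R hiding (zero)
  open Algebra.Solver.Ring.NaturalCoefficients.Default commutativeSemiring using (solve; _:=_; _:+_; _:*_)
  open Relation.Binary.Reasoning.Setoid setoid

  -- Each `add` is a single row operation, so `det-add-span` can recurse on the derivation. Vectors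
  -- are compared pointwise inside the constructors, and an index may occur several times.
  data Span {I : Set} (g : ℕ → I → Carrier) (n : ℕ) : (I → Carrier) → Set (c ⊔ ℓ) where
    none : ∀ {y} → (∀ i → y i ≈ 0#) → Span g n y
    add  : ∀ {y s} a {k} → k < n → Span g n s → (∀ i → y i ≈ a * g k i + s i) → Span g n y

  Monic : {I : Set} (g : ℕ → I → Carrier) (n : ℕ) → (I → Carrier) → Set (c ⊔ ℓ)
  Monic g n y = ∃[ s ] Span g n s ∧ (∀ i → y i ≈ g n i + s i)

  module _ {I : Set} {g : ℕ → I → Carrier} where

    Span-resp : ∀ {n x y} → Span g n x → (∀ i → y i ≈ x i) → Span g n y
    Span-resp (none x≈0)        y≈x = none λ i → trans (y≈x i) (x≈0 i)
    Span-resp (add a k<n s∈ x≈) y≈x = add a k<n s∈ λ i → trans (y≈x i) (x≈ i)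

    Span-+ : ∀ {n x y z} → Span g n x → Span g n y → (∀ i → z i ≈ x i + y i) → Span g n z
    Span-+ {y = y} (none x≈0) y∈ z≈ = Span-resp y∈ λ i →
      trans (z≈ i) (trans (+-congʳ (x≈0 i)) (+-identityˡ (y i)))
    Span-+ {y = y} {z} (add {s = s} a {k} k<n s∈ x≈) y∈ z≈ =
      add a k<n (Span-+ s∈ y∈ λ i → refl) λ i →
        trans (z≈ i) (trans (+-congʳ (x≈ i)) (+-assoc (a * g k i) (s i) (y i)))

    Span-weaken : ∀ {m n x} → m ≤ n → Span g m x → Span g n x
    Span-weaken m≤n (none x≈0)           = none x≈0
    Span-weaken m≤n (add a k<m s∈ x≈) = add a (ℕ.<-≤-trans k<m m≤n) (Span-weaken m≤n s∈) x≈

    Span-∙ : ∀ {n k} a {x} → k < n → (∀ i → x i ≈ a * g k i) → Span g n x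
    Span-∙ a k<n x≈ = add {s = λ _ → 0#} a k<n (none λ _ → refl) λ i → trans (x≈ i) (sym (+-identityʳ _))

    Span-* : ∀ {n x} a → Span g n x → Span g n (λ i → a * x i)
    Span-* a (none x≈0) = none λ i → trans (*-congˡ (x≈0 i)) (zeroʳ a)
    Span-* a (add {s = s} b {k} k<n s∈ x≈) = add (a * b) k<n (Span-* a s∈) λ i →
      trans (*-congˡ (x≈ i))
        (solve 4 (λ a b g s → a :* (b :* g :+ s) := (a :* b) :* g :+ a :* s) refl a b (g k i) (s i))

    -- A linear map that raises the degree by exactly one with leading coefficient 1 acts like
    -- multiplication by a variable: the leading term moves up and the lower terms stay below it.
    -- The triangularity claims about determinants are iterations of this. Linearity is phrased for
    -- pointwise equal families, so that `J` need not be known to respect such equality beforehand.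
    Monic-suc : (J : (I → Carrier) → I → Carrier) →
      (∀ {x} → (∀ i → x i ≈ 0#) → ∀ i → J x i ≈ 0#) →
      (∀ a {x y z} → (∀ i → z i ≈ a * x i + y i) → ∀ i → J z i ≈ a * J x i + J y i) →
      (∀ k → Monic g (suc k) (J (g k))) →
      ∀ {n x} → Monic g n x → Monic g (suc n) (J x)
    Monic-suc J J-0 J-linear J-g {n} {x} (s , s∈ , x≈) with J-g n
    ... | s′ , s′∈ , Jg≈ = (λ i → s′ i + J s i) , Span-+ s′∈ (J-Span s∈) (λ _ → refl) , λ i → begin
        J x i                        ≈⟨ J-linear 1# (λ i → trans (x≈ i) (+-congʳ (sym (*-identityˡ _)))) i ⟩
        1# * J (g n) i + J s i       ≈⟨ +-congʳ (*-identityˡ _) ⟩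
        J (g n) i + J s i            ≈⟨ +-congʳ (Jg≈ i) ⟩
        (g (suc n) i + s′ i) + J s i ≈⟨ +-assoc _ _ _ ⟩
        g (suc n) i + (s′ i + J s i) ∎
      where
      J-Span : ∀ {m y} → Span g m y → Span g (suc m) (J y)
      J-Span (none y≈0) = none (J-0 y≈0)
      J-Span {m} (add {s = y} a {k} k<m y∈ z≈) with J-g k
      ... | w , w∈ , Jg≈ = Span-+
        (add a (s≤s k<m) (Span-* a (Span-weaken (ℕ.m≤n⇒m≤1+n k<m) w∈))
          λ i → trans (*-congˡ (Jg≈ i)) (distribˡ a (g (suc k) i) (w i)))
        (J-Span y∈) (J-linear a z≈)

  Span-∘ : ∀ {I J : Set} (f : J → I) {g n x} → Span g n x → Span (λ k → g k ∘ f) n (x ∘ f)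
  Span-∘ f (none x≈0)           = none (x≈0 ∘ f)
  Span-∘ f (add a k<n s∈ x≈) = add a k<n (Span-∘ f s∈) (x≈ ∘ f)

  Monic-resp : ∀ {I : Set} {g : ℕ → I → Carrier} {n x y} → Monic g n x → (∀ i → y i ≈ x i) → Monic g n y
  Monic-resp (s , s∈ , x≈) y≈x = s , s∈ , λ i → trans (y≈x i) (x≈ i)

  -- Relations are found between sequences on all of ℕ and then restricted to the indices of a
  -- matrix: along `toℕ` for row vectors, along i ↦ 2i for column vectors.
  Monic-∘ : ∀ {I J : Set} (f : J → I) {g n x} → Monic g n x → Monic (λ k → g k ∘ f) n (x ∘ f)
  Monic-∘ f (s , s∈ , x≈) = s ∘ f , Span-∘ f s∈ , x≈ ∘ f

-- Determinants: multilinearity, transposition, alternation, scaling.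

module DeterminantProperties {c ℓ} (R : CommutativeRing c ℓ) where

  open CommutativeRing R hiding (zero)
  open Algebra.Definitions.RawSemiring (RawRing.rawSemiring rawRing) using (_^_; sum)
  open Algebra.Properties.Semiring.Exp semiring using (^-homo-*)
  open Algebra.Properties.Semiring.Sum semiring using (sum-cong-≋; sum-replicate-zero; *-distribˡ-sum)
  open Algebra.Properties.CommutativeMonoid.Sum +-commutativeMonoid using (∑-distrib-+; ∑-comm)
  open Algebra.Properties.Ring ring using (-1*x≈-x)
  open Algebra.Solver.Ring.NaturalCoefficients.Default commutativeSemiring using (solve; _:=_; _:+_; _:*_)
  open Relation.Binary.Reasoning.Setoid setoid
  open Determinant R
  open Span R

  Matrix : ℕ → Set c
  Matrix n = Vector (Vector Carrier n) n

  minor : ∀ {n} → Matrix (suc n) → Fin (suc n) → Matrix n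
  minor A j i = removeAt (tail A i) j

  sum-zero : ∀ {n} {f : Vector Carrier n} → (∀ i → f i ≈ 0#) → sum f ≈ 0#
  sum-zero {n} f≈0 = trans (sum-cong-≋ f≈0) (sum-replicate-zero n)

  det-cong : ∀ n {A B : Matrix n} → (∀ i j → A i j ≈ B i j) → det n A ≈ det n B
  det-cong zero    A≈B = refl
  det-cong (suc n) A≈B = sum-cong-≋ λ j →
    *-congˡ {(- 1#) ^ toℕ j} (*-cong (A≈B zero j) (det-cong n λ i k → A≈B (suc i) (punchIn j k)))

  -- Row zero enters the expansion linearly; any other row enters through the minors, by induction.
  -- The shape `a * B + E` gives additivity and homogeneity at once and fits the constructor `add`.
  det-linear : ∀ n (q : Fin n) a {A B E : Matrix n} →
    (∀ i → i ≢ q → ∀ j → A i j ≈ B i j) → (∀ i → i ≢ q → ∀ j → A i j ≈ E i j) →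
    (∀ j → A q j ≈ a * B q j + E q j) → det n A ≈ a * det n B + det n E
  det-linear (suc n) q a {A} {B} {E} A≈B A≈E Aq = begin
    sum (term A)                         ≈⟨ sum-cong-≋ (split q A≈B A≈E Aq) ⟩
    sum (λ j → a * term B j + term E j)  ≈⟨ ∑-distrib-+ (λ j → a * term B j) (term E) ⟩
    sum (λ j → a * term B j) + sum (term E)  ≈⟨ +-congʳ (*-distribˡ-sum a (term B)) ⟨
    a * sum (term B) + sum (term E)      ∎
    where
    term : Matrix (suc n) → Vector Carrier (suc n)
    term M j = (- 1#) ^ toℕ j * (head M j * det n (minor M j))

    split : ∀ q → (∀ i → i ≢ q → ∀ j → A i j ≈ B i j) → (∀ i → i ≢ q → ∀ j → A i j ≈ E i j) →
      (∀ j → A q j ≈ a * B q j + E q j) → ∀ j → term A j ≈ a * term B j + term E j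
    split zero A≈B A≈E Aq j = begin
      s * (A zero j * det n (minor A j))
        ≈⟨ *-congˡ (*-congʳ (Aq j)) ⟩
      s * ((a * B zero j + E zero j) * det n (minor A j))
        ≈⟨ solve 5 (λ s a b c d → s :* ((a :* b :+ c) :* d) := a :* (s :* (b :* d)) :+ s :* (c :* d))
             refl s a (B zero j) (E zero j) (det n (minor A j)) ⟩
      a * (s * (B zero j * det n (minor A j))) + s * (E zero j * det n (minor A j))
        ≈⟨ +-cong (*-congˡ (*-congˡ (*-congˡ (det-cong n λ i k → A≈B (suc i) (λ ()) (punchIn j k)))))
                  (*-congˡ (*-congˡ (det-cong n λ i k → A≈E (suc i) (λ ()) (punchIn j k)))) ⟩
      a * term B j + term E j ∎
      where s = (- 1#) ^ toℕ j
    split (suc q) A≈B A≈E Aq j = begin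
      s * (A zero j * det n (minor A j))
        ≈⟨ *-congˡ (*-congˡ (det-linear n q a
             (λ i i≢q k → A≈B (suc i) (i≢q ∘ suc-injective) (punchIn j k))
             (λ i i≢q k → A≈E (suc i) (i≢q ∘ suc-injective) (punchIn j k))
             (λ k → Aq (punchIn j k)))) ⟩
      s * (A zero j * (a * det n (minor B j) + det n (minor E j)))
        ≈⟨ solve 5 (λ s a x d e → s :* (x :* (a :* d :+ e)) := a :* (s :* (x :* d)) :+ s :* (x :* e))
             refl s a (A zero j) (det n (minor B j)) (det n (minor E j)) ⟩
      a * (s * (A zero j * det n (minor B j))) + s * (A zero j * det n (minor E j))
        ≈⟨ +-cong (*-congˡ (*-congˡ (*-congʳ (A≈B zero (λ ()) j))))
                  (*-congˡ (*-congʳ (A≈E zero (λ ()) j))) ⟩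
      a * term B j + term E j ∎
      where s = (- 1#) ^ toℕ j

  _ᵀ : ∀ {n} → Matrix n → Matrix n
  (A ᵀ) i j = A j i

  private
    minor² : ∀ {n} → Matrix (suc (suc n)) → Fin (suc n) → Fin (suc n) → Matrix n
    minor² A i j p q = A (suc (punchIn i p)) (suc (punchIn j q))

  -- Expanding the minors of the first row along the first column makes the
  -- double sum symmetric.
  det-ᵀ : ∀ n (A : Matrix n) → det n A ≈ det n (A ᵀ)
  det-ᵀ zero          A = refl
  det-ᵀ (suc zero)    A = refl
  det-ᵀ (suc (suc n)) A = +-cong
    (*-congˡ (*-congˡ (det-ᵀ (suc n) (minor A zero))))
    (begin
      sum (λ j → sgn (suc j) * (A zero (suc j) * det (suc n) (minor A (suc j))))
        ≈⟨ sum-cong-≋ (λ j → trans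
             (*-congˡ (*-congˡ (trans (det-ᵀ (suc n) (minor A (suc j)))
               (sum-cong-≋ λ i → *-congˡ {sgn i} (*-congˡ {A (suc i) zero}
                 (det-ᵀ n (minor² A i j ᵀ)))))))
             (spread (sgn (suc j)) (A zero (suc j)) (λ i → sgn i) (λ i → A (suc i) zero)
                     (λ i → det n (minor² A i j)))) ⟩
      sum (λ j → sum (λ i → sgn (suc j) * (A zero (suc j) * (sgn i * (A (suc i) zero * det n (minor² A i j))))))
        ≈⟨ ∑-comm (λ j i → sgn (suc j) * (A zero (suc j) * (sgn i * (A (suc i) zero * det n (minor² A i j))))) ⟩
      sum (λ i → sum (λ j → sgn (suc j) * (A zero (suc j) * (sgn i * (A (suc i) zero * det n (minor² A i j))))))
        ≈⟨ sum-cong-≋ (λ i → trans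
             (sum-cong-≋ λ j → exchange (sgn j) (A zero (suc j)) (sgn i) (A (suc i) zero) (det n (minor² A i j)))
             (sym (spread (sgn (suc i)) (A (suc i) zero) (λ j → sgn j) (λ j → A zero (suc j))
                     (λ j → det n (minor² A i j))))) ⟩
      sum (λ i → sgn (suc i) * (A (suc i) zero * sum (λ j → sgn j * (A zero (suc j) * det n (minor² A i j)))))
        ≈⟨ sum-cong-≋ (λ i → *-congˡ {sgn (suc i)} (*-congˡ {A (suc i) zero}
             (sym (det-ᵀ (suc n) (minor (A ᵀ) (suc i)))))) ⟩
      sum (λ i → sgn (suc i) * (A (suc i) zero * det (suc n) (minor (A ᵀ) (suc i)))) ∎)
    where
    sgn : ∀ {m} → Fin m → Carrier
    sgn i = (- 1#) ^ toℕ i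

    spread : ∀ {m} a b (f g h : Vector Carrier m) →
      a * (b * sum (λ i → f i * (g i * h i))) ≈ sum (λ i → a * (b * (f i * (g i * h i))))
    spread a b f g h = trans (*-congˡ (*-distribˡ-sum b (λ i → f i * (g i * h i))))
      (*-distribˡ-sum a (λ i → b * (f i * (g i * h i))))

    exchange : ∀ s x s′ y d →
      (- 1# * s) * (x * (s′ * (y * d))) ≈ (- 1# * s′) * (y * (s * (x * d)))
    exchange = solve 6 (λ m s x s′ y d →
      (m :* s) :* (x :* (s′ :* (y :* d))) := (m :* s′) :* (y :* (s :* (x :* d)))) refl (- 1#)

  -- The first two terms of the expansion have equal minors and opposite signs; every later minor
  -- still contains both equal columns and vanishes by induction. Expansion along a row makes
  -- columns the easy case, and rows follow by transposition.
  det-columns₀₁-equal : ∀ n (A : Matrix (suc (suc n))) →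
    (∀ i → A i zero ≈ A i (suc zero)) → det (suc (suc n)) A ≈ 0#
  det-columns₀₁-equal n A eq = begin
    1# * (A zero zero * det (suc n) (minor A zero))
      + ((- 1# * 1#) * (A zero (suc zero) * det (suc n) (minor A (suc zero))) + sum rest)
      ≈⟨ +-assoc _ _ _ ⟨
    (1# * (A zero zero * det (suc n) (minor A zero))
      + (- 1# * 1#) * (A zero (suc zero) * det (suc n) (minor A (suc zero)))) + sum rest
      ≈⟨ +-cong (+-congˡ (*-congˡ (*-cong (sym (eq zero)) (det-cong (suc n) (λ i → minor₁≈minor₀ i)))))
                (sum-zero (rest≈0 n A eq)) ⟩
    (1# * d + (- 1# * 1#) * d) + 0#
      ≈⟨ +-identityʳ _ ⟩
    1# * d + (- 1# * 1#) * d
      ≈⟨ +-cong (*-identityˡ d) (trans (*-congʳ (*-identityʳ _)) (-1*x≈-x d)) ⟩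
    d + - d
      ≈⟨ -‿inverseʳ d ⟩
    0# ∎
    where
    d = A zero zero * det (suc n) (minor A zero)

    rest : Vector Carrier n
    rest j = (- 1#) ^ toℕ (suc (suc j)) * (A zero (suc (suc j)) * det (suc n) (minor A (suc (suc j))))

    minor₁≈minor₀ : ∀ i j → minor A (suc zero) i j ≈ minor A zero i j
    minor₁≈minor₀ i zero    = eq (suc i)
    minor₁≈minor₀ i (suc j) = refl

    rest≈0 : ∀ n (A : Matrix (suc (suc n))) → (∀ i → A i zero ≈ A i (suc zero)) → ∀ (j : Fin n) →
      (- 1#) ^ toℕ (suc (suc j)) * (A zero (suc (suc j)) * det (suc n) (minor A (suc (suc j)))) ≈ 0#
    rest≈0 (suc n) A eq j = trans
      (*-congˡ (trans (*-congˡ (det-columns₀₁-equal n (minor A (suc (suc j))) (eq ∘ suc))) (zeroʳ _)))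
      (zeroʳ _)

  det-rows₀₁-equal : ∀ n (A : Matrix (suc (suc n))) →
    (∀ j → A zero j ≈ A (suc zero) j) → det (suc (suc n)) A ≈ 0#
  det-rows₀₁-equal n A eq = trans (det-ᵀ (suc (suc n)) A) (det-columns₀₁-equal n (A ᵀ) eq)

  private
    -- Polarization: det (x + y, x + y, …) vanishes, and so do det (x, x, …) and det (y, y, …).
    det-swap₀₁ : ∀ n (A : Matrix (suc (suc n))) x y (B : Matrix (suc (suc n))) →
      (∀ j → A zero j ≈ x j) → (∀ j → A (suc zero) j ≈ y j) →
      (∀ j → B zero j ≈ y j) → (∀ j → B (suc zero) j ≈ x j) →
      (∀ i j → A (suc (suc i)) j ≈ B (suc (suc i)) j) →
      det (suc (suc n)) B ≈ 0# → det (suc (suc n)) A ≈ 0#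
    det-swap₀₁ n A x y B A₀ A₁ B₀ B₁ A≈B detB≈0 = begin
      det₂ A                            ≈⟨ det-cong (suc (suc n)) A≈[x,y] ⟩
      D x y                             ≈⟨ *-identityˡ _ ⟨
      1# * D x y                        ≈⟨ +-identityʳ _ ⟨
      1# * D x y + 0#                   ≈⟨ +-congˡ (D-alt y) ⟨
      1# * D x y + D y y                ≈⟨ D-linear₀ y ⟨
      D (x ∔ y) y                       ≈⟨ +-identityˡ _ ⟨
      0# + D (x ∔ y) y                  ≈⟨ +-congʳ (zero-part) ⟨
      1# * D (x ∔ y) x + D (x ∔ y) y    ≈⟨ D-linear₁ (x ∔ y) ⟨
      D (x ∔ y) (x ∔ y)                 ≈⟨ D-alt (x ∔ y) ⟩
      0#                                ∎
      where
      det₂ = det (suc (suc n))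

      [_,_] : (u w : Vector Carrier (suc (suc n))) → Matrix (suc (suc n))
      [ u , w ] zero          = u
      [ u , w ] (suc zero)    = w
      [ u , w ] (suc (suc i)) = A (suc (suc i))

      D : (u w : Vector Carrier (suc (suc n))) → Carrier
      D u w = det₂ [ u , w ]

      _∔_ : (u w : Vector Carrier (suc (suc n))) → Vector Carrier (suc (suc n))
      (u ∔ w) j = u j + w j

      A≈[x,y] : ∀ i j → A i j ≈ [ x , y ] i j
      A≈[x,y] zero          = A₀
      A≈[x,y] (suc zero)    = A₁
      A≈[x,y] (suc (suc i)) = λ _ → refl

      [y,x]≈B : ∀ i j → [ y , x ] i j ≈ B i j
      [y,x]≈B zero          = sym ∘ B₀
      [y,x]≈B (suc zero)    = sym ∘ B₁
      [y,x]≈B (suc (suc i)) = A≈B i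

      D-alt : ∀ u → D u u ≈ 0#
      D-alt u = det-rows₀₁-equal n [ u , u ] (λ _ → refl)

      D-linear₀ : ∀ w → D (x ∔ y) w ≈ 1# * D x w + D y w
      D-linear₀ w = det-linear (suc (suc n)) zero 1# (off x) (off y)
        (λ j → +-congʳ (sym (*-identityˡ (x j))))
        where
        off : ∀ u i → i ≢ zero → ∀ j → [ x ∔ y , w ] i j ≈ [ u , w ] i j
        off u zero          i≢0 = ⊥-elim (i≢0 ≡.refl)
        off u (suc zero)    i≢0 = λ _ → refl
        off u (suc (suc i)) i≢0 = λ _ → refl

      D-linear₁ : ∀ u → D u (x ∔ y) ≈ 1# * D u x + D u y
      D-linear₁ u = det-linear (suc (suc n)) (suc zero) 1# (off x) (off y)
        (λ j → +-congʳ (sym (*-identityˡ (x j))))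
        where
        off : ∀ w i → i ≢ suc zero → ∀ j → [ u , x ∔ y ] i j ≈ [ u , w ] i j
        off w zero          i≢1 = λ _ → refl
        off w (suc zero)    i≢1 = ⊥-elim (i≢1 ≡.refl)
        off w (suc (suc i)) i≢1 = λ _ → refl

      zero-part : 1# * D (x ∔ y) x ≈ 0#
      zero-part = begin
        1# * D (x ∔ y) x      ≈⟨ *-identityˡ _ ⟩
        D (x ∔ y) x           ≈⟨ D-linear₀ x ⟩
        1# * D x x + D y x    ≈⟨ +-cong (trans (*-identityˡ _) (D-alt x))
                                        (trans (det-cong (suc (suc n)) [y,x]≈B) detB≈0) ⟩
        0# + 0#               ≈⟨ +-identityˡ _ ⟩
        0#                    ∎

  -- If both rows lie below row zero, they survive in every minor. If row zero is one of them and
  -- row one is not the other, exchanging rows zero and one reduces to that situation.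
  det-rows-equal : ∀ n (A : Matrix n) {p q} → toℕ p < toℕ q → (∀ j → A p j ≈ A q j) → det n A ≈ 0#
  det-rows-equal (suc (suc n)) A {zero} {suc zero} p<q eq = det-rows₀₁-equal n A eq
  det-rows-equal (suc (suc n)) A {zero} {suc (suc q)} p<q eq =
    det-swap₀₁ n A (A zero) (A (suc zero)) B (λ _ → refl) (λ _ → refl) (λ _ → refl) (λ _ → refl) (λ _ _ → refl)
      (sum-zero λ j → trans (*-congˡ {(- 1#) ^ toℕ j} (trans (*-congˡ {head B j} (det-rows-equal (suc n) (minor B j)
        {zero} {suc q} (s≤s z≤n) (eq ∘ punchIn j))) (zeroʳ _))) (zeroʳ _))
    where
    B : Matrix (suc (suc n))
    B zero          = A (suc zero)
    B (suc zero)    = A zero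
    B (suc (suc i)) = A (suc (suc i))
  det-rows-equal (suc n) A {suc p} {suc q} (s≤s p<q) eq =
    sum-zero λ j → trans (*-congˡ {(- 1#) ^ toℕ j} (trans (*-congˡ {head A j} (det-rows-equal n (minor A j)
      p<q (eq ∘ punchIn j))) (zeroʳ _))) (zeroʳ _)

  private
    -- The rows above `q` already agree with `g`, so every vector `g k` with k < m is itself a row
    -- of the matrix. Each `add` therefore splits off a determinant with two equal rows.
    det-add-span : ∀ n (q : Fin n) {A B : Matrix n} {g : ℕ → Fin n → Carrier} {m y} → toℕ q ≡ m →
      (∀ i → toℕ i < m → ∀ j → A i j ≈ g (toℕ i) j) →
      (∀ i → i ≢ q → ∀ j → B i j ≈ A i j) →
      Span g m y → (∀ j → B q j ≈ A q j + y j) → det n B ≈ det n A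
    det-add-span n q {A} {B} q≡m A≈g B≈A (none y≈0) Bq = det-cong n B≈A′
      where
      B≈A′ : ∀ i j → B i j ≈ A i j
      B≈A′ i j with i ≟ᶠ q
      ... | yes ≡.refl = trans (Bq j) (trans (+-congˡ (y≈0 j)) (+-identityʳ _))
      ... | no i≢q     = B≈A i i≢q j
    det-add-span n q {A} {B} {g} {m} {y} ≡.refl A≈g B≈A (add {s = s} a {k} k<m s∈ y≈) Bq = begin
      det n B                    ≈⟨ det-linear n q a (off (g k)) (off (λ j → A q j + s j)) Bq′ ⟩
      a * det n E + det n F      ≈⟨ +-cong (trans (*-congˡ E≈0) (zeroʳ a)) F≈A ⟩
      0# + det n A               ≈⟨ +-identityˡ _ ⟩
      det n A                    ∎
      where
      [_] : Vector Carrier n → Matrix n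
      [ u ] = updateAt A q (const u)

      E = [ g k ]
      F = [ (λ j → A q j + s j) ]

      at-q : ∀ u j → [ u ] q j ≡ u j
      at-q u j = ≡.cong (λ row → row j) (updateAt-updates q A)

      off-q : ∀ u i → i ≢ q → ∀ j → [ u ] i j ≡ A i j
      off-q u i i≢q j = ≡.cong (λ row → row j) (updateAt-minimal i q A i≢q)

      off : ∀ u i → i ≢ q → ∀ j → B i j ≈ [ u ] i j
      off u i i≢q j = trans (B≈A i i≢q j) (reflexive (≡.sym (off-q u i i≢q j)))

      Bq′ : ∀ j → B q j ≈ a * E q j + F q j
      Bq′ j = begin
        B q j                          ≈⟨ Bq j ⟩
        A q j + y j                    ≈⟨ +-congˡ (y≈ j) ⟩
        A q j + (a * g k j + s j)      ≈⟨ solve 3 (λ x y z → x :+ (y :+ z) := y :+ (x :+ z)) refl (A q j) (a * g k j) (s j) ⟩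
        a * g k j + (A q j + s j)      ≡⟨ ≡.cong₂ (λ e f → a * e + f) (at-q _ j) (at-q _ j) ⟨
        a * E q j + F q j              ∎

      k<n : k < n
      k<n = ℕ.<-trans k<m (toℕ<n q)

      p = fromℕ< k<n

      p<q : toℕ p < toℕ q
      p<q = ≡.subst (_< toℕ q) (≡.sym (toℕ-fromℕ< k<n)) k<m

      E≈0 : det n E ≈ 0#
      E≈0 = det-rows-equal n E p<q λ j → begin
        E p j            ≡⟨ off-q (g k) p (λ p≡q → ℕ.<⇒≢ p<q (≡.cong toℕ p≡q)) j ⟩
        A p j            ≈⟨ A≈g p p<q j ⟩
        g (toℕ p) j      ≡⟨ ≡.cong (λ i → g i j) (toℕ-fromℕ< k<n) ⟩
        g k j            ≡⟨ at-q (g k) j ⟨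
        E q j            ∎

      F≈A : det n F ≈ det n A
      F≈A = det-add-span n q ≡.refl A≈g (λ i i≢q j → reflexive (off-q _ i i≢q j)) s∈
        (λ j → reflexive (at-q _ j))

  -- Rows are replaced from the top down: `hybrid m` has the first m rows from `g` and the others
  -- from `y`. When row m is treated, the vectors needed to clear it are thus already in place.
  det-unitriangularˡ : ∀ n (g y : ℕ → Fin n → Carrier) → (∀ i → Monic g i (y i)) →
    det n (λ i → y (toℕ i)) ≈ det n (λ i → g (toℕ i))
  det-unitriangularˡ n g y y-monic = trans (steps n ℕ.≤-refl)
      (det-cong n λ i j → hybrid-low n i j (toℕ<n i))
    where
    hybrid : ℕ → Matrix n
    hybrid m i with toℕ i ℕ.<? m
    ... | yes _ = g (toℕ i)
    ... | no _  = y (toℕ i)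

    hybrid-low : ∀ m i j → toℕ i < m → hybrid m i j ≈ g (toℕ i) j
    hybrid-low m i j i<m with toℕ i ℕ.<? m
    ... | yes _  = refl
    ... | no i≮m = ⊥-elim (i≮m i<m)

    hybrid-high : ∀ m i j → m ≤ toℕ i → hybrid m i j ≈ y (toℕ i) j
    hybrid-high m i j m≤i with toℕ i ℕ.<? m
    ... | yes i<m = ⊥-elim (ℕ.≤⇒≯ m≤i i<m)
    ... | no _    = refl

    hybrid-suc : ∀ m i j → toℕ i ≢ m → hybrid m i j ≈ hybrid (suc m) i j
    hybrid-suc m i j i≢m with toℕ i ℕ.<? m
    ... | yes i<m = sym (hybrid-low (suc m) i j (ℕ.m<n⇒m<1+n i<m))
    ... | no i≮m  = sym (hybrid-high (suc m) i j (ℕ.≤∧≢⇒< (ℕ.≮⇒≥ i≮m) (i≢m ∘ ≡.sym)))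

    step : ∀ m → m < n → det n (hybrid m) ≈ det n (hybrid (suc m))
    step m m<n with y-monic m
    ... | s , s∈ , ym≈ = det-add-span n q q≡m
      (λ i i<m j → hybrid-low (suc m) i j (ℕ.m<n⇒m<1+n i<m))
      (λ i i≢q j → hybrid-suc m i j (i≢q ∘ toℕ-injective ∘ (λ i≡m → ≡.trans i≡m (≡.sym q≡m))))
      s∈
      (λ j → begin
        hybrid m q j                  ≈⟨ hybrid-high m q j (ℕ.≤-reflexive (≡.sym q≡m)) ⟩
        y (toℕ q) j                   ≡⟨ ≡.cong (λ i → y i j) q≡m ⟩
        y m j                         ≈⟨ ym≈ j ⟩
        g m j + s j                   ≡⟨ ≡.cong (λ i → g i j + s j) q≡m ⟨
        g (toℕ q) j + s j             ≈⟨ +-congʳ (hybrid-low (suc m) q j (s≤s (ℕ.≤-reflexive q≡m))) ⟨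
        hybrid (suc m) q j + s j      ∎)
      where
      q = fromℕ< m<n
      q≡m = toℕ-fromℕ< m<n

    steps : ∀ m → m ≤ n → det n (λ i → y (toℕ i)) ≈ det n (hybrid m)
    steps zero    _   = det-cong n λ i j → sym (hybrid-high zero i j z≤n)
    steps (suc m) m<n = trans (steps m (ℕ.<⇒≤ m<n)) (step m m<n)

  det-unitriangularʳ : ∀ n (g y : ℕ → Fin n → Carrier) → (∀ j → Monic g j (y j)) →
    det n (λ i j → y (toℕ j) i) ≈ det n (λ i j → g (toℕ j) i)
  det-unitriangularʳ n g y y-monic = trans (det-ᵀ n (λ i j → y (toℕ j) i))
    (trans (det-unitriangularˡ n g y y-monic) (det-ᵀ n (λ i → g (toℕ i))))

  det-scale : ∀ n a (A : Matrix n) → det n (λ i j → a * A i j) ≈ a ^ n * det n A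
  det-scale zero    a A = sym (*-identityˡ 1#)
  det-scale (suc n) a A = trans
    (sum-cong-≋ λ j → trans
      (*-congˡ {(- 1#) ^ toℕ j} (*-congˡ {a * head A j} (det-scale n a (minor A j))))
      (solve 5 (λ s a x b d → s :* ((a :* x) :* (b :* d)) := (a :* b) :* (s :* (x :* d))) refl
        ((- 1#) ^ toℕ j) a (head A j) (a ^ n) (det n (minor A j))))
    (sym (*-distribˡ-sum (a ^ suc n) (λ j → (- 1#) ^ toℕ j * (head A j * det n (minor A j)))))

  -- The exponent is 0 + 1 + ... + (n - 1). In the induction each row of a minor carries one factor
  -- `a` more than its new index indicates, which yields `a ^ n`, and the exponents add up by
  -- Pascal's rule.
  det-scale-rows : ∀ n a (A : Matrix n) → det n (λ i j → a ^ toℕ i * A i j) ≈ a ^ (n C 2) * det n A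
  det-scale-rows zero    a A = sym (*-identityˡ 1#)
  det-scale-rows (suc n) a A = trans
    (sum-cong-≋ λ j → trans
      (*-congˡ {(- 1#) ^ toℕ j} (*-congˡ {1# * head A j} (begin
        det n (λ i k → (a * a ^ toℕ i) * minor A j i k)
          ≈⟨ det-cong n (λ i k → *-assoc a (a ^ toℕ i) (minor A j i k)) ⟩
        det n (λ i k → a * (a ^ toℕ i * minor A j i k))
          ≈⟨ det-scale n a (λ i k → a ^ toℕ i * minor A j i k) ⟩
        a ^ n * det n (λ i k → a ^ toℕ i * minor A j i k)
          ≈⟨ *-congˡ (det-scale-rows n a (minor A j)) ⟩
        a ^ n * (a ^ (n C 2) * det n (minor A j))
          ≈⟨ *-assoc _ _ _ ⟨
        a ^ n * a ^ (n C 2) * det n (minor A j)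
          ≈⟨ *-congʳ (^-homo-* a n (n C 2)) ⟨
        a ^ (n ℕ.+ n C 2) * det n (minor A j)
          ≡⟨ ≡.cong (λ e → a ^ e * det n (minor A j)) n+nC2 ⟩
        a ^ (suc n C 2) * det n (minor A j) ∎)))
      (trans (*-congˡ {(- 1#) ^ toℕ j} (*-congʳ {a ^ (suc n C 2) * det n (minor A j)} (*-identityˡ (head A j))))
        (solve 4 (λ s x b d → s :* (x :* (b :* d)) := b :* (s :* (x :* d))) refl
          ((- 1#) ^ toℕ j) (head A j) (a ^ (suc n C 2)) (det n (minor A j)))))
    (sym (*-distribˡ-sum (a ^ (suc n C 2)) (λ j → (- 1#) ^ toℕ j * (head A j * det n (minor A j)))))
    where
    n+nC2 : n ℕ.+ n C 2 ≡ suc n C 2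
    n+nC2 = ≡.trans (≡.cong (ℕ._+ n C 2) (≡.sym (nC1≡n n))) (nCk+nC[k+1]≡[n+1]C[k+1] n 1)

  det-scale-columns : ∀ n a (A : Matrix n) → det n (λ i j → a ^ toℕ j * A i j) ≈ a ^ (n C 2) * det n A
  det-scale-columns n a A = trans (det-ᵀ n (λ i j → a ^ toℕ j * A i j))
    (trans (det-scale-rows n a (A ᵀ)) (*-congˡ (sym (det-ᵀ n A))))

-- From the recurrence of the derivatives to rising factorials.

module HankelReduction {c ℓ} (R : CommutativeRing c ℓ) (ρ : CommutativeRing.Carrier R) where

  open CommutativeRing R hiding (zero)
  open Algebra.Definitions.RawSemiring (RawRing.rawSemiring rawRing) using (_^_; _×_)
  open Algebra.Properties.Semiring.Exp semiring using (^-congˡ; ^-homo-*; ^-assocʳ)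
  open Algebra.Properties.CommutativeSemiring.Exp commutativeSemiring using (^-distrib-*)
  open Algebra.Solver.Ring.NaturalCoefficients.Default commutativeSemiring using (solve; _:=_; _:+_; _:*_; con)
  open Relation.Binary.Reasoning.Setoid setoid
  open Determinant R
  open DeterminantProperties R
  open Span R

  ι : ℕ → Carrier
  ι n = n × 1#

  rising : ℕ → Carrier
  rising zero    = 1#
  rising (suc k) = rising k * (ρ + ι k)

  -- Splitting off the top factor q instead of the last factor q - l + 1 avoids subtraction and
  -- gives 0 for l > q.
  falling : ℕ → ℕ → Carrier
  falling q       zero    = 1#
  falling zero    (suc l) = 0#
  falling (suc q) (suc l) = ι (suc q) * falling q l

  -- This is the rule that multiplication by q - l lengthens the falling factorial by one factor,
  -- with l moved to the other side to make it a semiring identity.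
  falling-suc : ∀ q l → falling q (suc l) + ι l * falling q l ≈ ι q * falling q l
  falling-suc zero    zero    = +-identityˡ _
  falling-suc zero    (suc l) = trans (+-congˡ (zeroʳ (ι (suc l)))) (trans (+-identityˡ _) (sym (zeroʳ (ι zero))))
  falling-suc (suc q) zero    = trans (+-congˡ (zeroˡ 1#)) (+-identityʳ _)
  falling-suc (suc q) (suc l) = begin
    ι (suc q) * falling q (suc l) + (1# + ι l) * (ι (suc q) * falling q l)
      ≈⟨ solve 4 (λ q′ f l g → q′ :* f :+ (con 1 :+ l) :* (q′ :* g) := q′ :* ((f :+ l :* g) :+ g))
           refl (ι (suc q)) (falling q (suc l)) (ι l) (falling q l) ⟩
    ι (suc q) * ((falling q (suc l) + ι l * falling q l) + falling q l)
      ≈⟨ *-congˡ (+-congʳ (falling-suc q l)) ⟩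
    ι (suc q) * (ι q * falling q l + falling q l)
      ≈⟨ solve 2 (λ q g → (con 1 :+ q) :* (q :* g :+ g) := (con 1 :+ q) :* ((con 1 :+ q) :* g))
           refl (ι q) (falling q l) ⟩
    ι (suc q) * (ι (suc q) * falling q l) ∎

  -- Pascal's rule for binomial coefficients, multiplied by (l + 1)!.
  falling-pascal : ∀ q l → falling (suc q) (suc l) ≈ falling q (suc l) + ι (suc l) * falling q l
  falling-pascal q l = begin
    (1# + ι q) * falling q l                       ≈⟨ solve 2 (λ q g → (con 1 :+ q) :* g := q :* g :+ g) refl (ι q) (falling q l) ⟩
    ι q * falling q l + falling q l                ≈⟨ +-congʳ (falling-suc q l) ⟨
    falling q (suc l) + ι l * falling q l + falling q l
      ≈⟨ solve 3 (λ f l g → f :+ l :* g :+ g := f :+ (con 1 :+ l) :* g) refl (falling q (suc l)) (ι l) (falling q l) ⟩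
    falling q (suc l) + (1# + ι l) * falling q l   ∎

  module _ (n : ℕ) where

    private
      g y : ℕ → ℕ → Carrier
      g l q = falling q l * rising q
      y j q = rising (q ℕ.+ j)

      times : ℕ → (ℕ → Carrier) → ℕ → Carrier
      times j x q = (ρ + ι (q ℕ.+ j)) * x q

      ι-+ : ∀ m n → ι (m ℕ.+ n) ≈ ι m + ι n
      ι-+ zero    n = sym (+-identityˡ _)
      ι-+ (suc m) n = trans (+-congˡ (ι-+ m n)) (sym (+-assoc _ _ _))

      -- Write ρ + q + j = (q - l) + (l + ρ + j): the first part raises the degree of the falling
      -- factorial, the second is constant in q.
      times-g : ∀ j l → Monic g (suc l) (times j (g l))
      times-g j l = (λ q → (ι l + (ρ + ι j)) * g l q) , Span-∙ _ (ℕ.n<1+n l) (λ _ → refl) , λ q → begin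
        (ρ + ι (q ℕ.+ j)) * (falling q l * rising q)
          ≈⟨ *-congʳ (+-congˡ (ι-+ q j)) ⟩
        (ρ + (ι q + ι j)) * (falling q l * rising q)
          ≈⟨ solve 5 (λ p q j f g → (p :+ (q :+ j)) :* (f :* g) := q :* f :* g :+ (p :+ j) :* (f :* g))
               refl ρ (ι q) (ι j) (falling q l) (rising q) ⟩
        ι q * falling q l * rising q + (ρ + ι j) * (falling q l * rising q)
          ≈⟨ +-congʳ (*-congʳ (falling-suc q l)) ⟨
        (falling q (suc l) + ι l * falling q l) * rising q + (ρ + ι j) * (falling q l * rising q)
          ≈⟨ solve 5 (λ h l f r a → (h :+ l :* f) :* r :+ a :* (f :* r) := h :* r :+ (l :+ a) :* (f :* r))
               refl (falling q (suc l)) (ι l) (falling q l) (rising q) (ρ + ι j) ⟩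
        falling q (suc l) * rising q + (ι l + (ρ + ι j)) * (falling q l * rising q) ∎

      y-monic : ∀ j → Monic g j (y j)
      y-monic zero = (λ _ → 0#) , none (λ _ → refl) , λ q → begin
        rising (q ℕ.+ 0)             ≡⟨ ≡.cong rising (ℕ.+-identityʳ q) ⟩
        rising q                     ≈⟨ *-identityˡ _ ⟨
        1# * rising q                ≈⟨ +-identityʳ _ ⟨
        1# * rising q + 0#           ∎
      y-monic (suc j) = Monic-resp
        (Monic-suc (times j)
          (λ x≈0 q → trans (*-congˡ (x≈0 q)) (zeroʳ _))
          (λ a {x} {y} z≈ q → trans (*-congˡ (z≈ q))
            (solve 4 (λ p a x y → p :* (a :* x :+ y) := a :* (p :* x) :+ p :* y) refl (ρ + ι (q ℕ.+ j)) a (x q) (y q)))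
          (times-g j) (y-monic j))
        λ q → trans (reflexive (≡.cong rising (ℕ.+-suc q j))) (*-comm _ _)

    det-rising : det n (λ i j → rising (2 ℕ.* toℕ i ℕ.+ toℕ j)) ≈
      det n (λ i j → falling (2 ℕ.* toℕ i) (toℕ j) * rising (2 ℕ.* toℕ i))
    det-rising = det-unitriangularʳ n (λ l i → g l (2 ℕ.* toℕ i)) (λ j i → y j (2 ℕ.* toℕ i))
      (λ j → Monic-∘ (λ i → 2 ℕ.* toℕ i) (y-monic j))

  module _ (t : Carrier) where

    private
      u = t * t
      v = 1# + t * t

    -- On X(z) = Σ x_l z^l / l! this is the operator (1 + 2uz + uvz²) d/dz + ρu (1 + vz).
    A : (ℕ → Carrier) → ℕ → Carrier
    A x zero    = x 1 + (ρ * u) * x 0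
    A x (suc l) = x (suc (suc l)) + (ρ + (ι (suc l) + ι (suc l))) * u * x (suc l)
                  + ι (suc l) * (ρ + ι l) * (u * v) * x l

    A-0 : ∀ {x} → (∀ l → x l ≈ 0#) → ∀ l → A x l ≈ 0#
    A-0 x≈0 zero    = trans (+-cong (x≈0 1) (trans (*-congˡ (x≈0 0)) (zeroʳ _))) (+-identityˡ _)
    A-0 x≈0 (suc l) = trans (+-cong (trans (+-cong (x≈0 (suc (suc l))) (trans (*-congˡ (x≈0 (suc l))) (zeroʳ _))) (+-identityˡ _))
                                   (trans (*-congˡ (x≈0 l)) (zeroʳ _))) (+-identityˡ _)

    A-linear : ∀ a {x y z} → (∀ l → z l ≈ a * x l + y l) → ∀ l → A z l ≈ a * A x l + A y l
    A-linear a {x} {y} z≈ zero    = trans (+-cong (z≈ 1) (*-congˡ (z≈ 0)))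
      (solve 6 (λ a b x y x′ y′ → (a :* x :+ y) :+ b :* (a :* x′ :+ y′) := a :* (x :+ b :* x′) :+ (y :+ b :* y′))
        refl a (ρ * u) (x 1) (y 1) (x 0) (y 0))
    A-linear a {x} {y} z≈ (suc l) = trans (+-cong (+-cong (z≈ (suc (suc l))) (*-congˡ (z≈ (suc l)))) (*-congˡ (z≈ l)))
      (solve 9 (λ a b c x y x′ y′ x″ y″ →
          (a :* x :+ y) :+ b :* (a :* x′ :+ y′) :+ c :* (a :* x″ :+ y″)
          := a :* (x :+ b :* x′ :+ c :* x″) :+ (y :+ b :* y′ :+ c :* y″))
        refl a ((ρ + (ι (suc l) + ι (suc l))) * u) (ι (suc l) * (ρ + ι l) * (u * v))
        (x (suc (suc l))) (y (suc (suc l))) (x (suc l)) (y (suc l)) (x l) (y l))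

    -- The generating function Σ μ_q(l) z^l / l! is u^q `rising q` w^q with w = 1 + vz. Since v = 1
    -- + u, the operator `A` becomes (1 + uw²) d/dw + ρuw in the variable w, and sends w^q to q
    -- w^(q-1) + (ρ + q) u w^(q+1). The factor u^q `rising q` normalises the upper coefficient to 1.
    μ : ℕ → ℕ → Carrier
    μ q l = v ^ l * (u ^ q * (falling q l * rising q))

    μ-lower : ℕ → ℕ → Carrier
    μ-lower zero    l = 0#
    μ-lower (suc q) l = (ι (suc q) * (ρ + ι q) * u) * μ q l

    private
      falling₁ : ∀ q → falling q 1 ≈ ι q
      falling₁ zero    = refl
      falling₁ (suc q) = *-identityʳ _

      -- The middle coefficient is shared out: one (l + 1) joins the first term, the other joins the
      -- last, and each group collapses by `falling-suc`; the part with ρ is Pascal's rule.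
      falling-A : ∀ q l → falling q (suc (suc l)) + (ρ + (ι (suc l) + ι (suc l))) * falling q (suc l)
          + ι (suc l) * (ρ + ι l) * falling q l
        ≈ (ρ + ι q) * falling (suc q) (suc l)
      falling-A q l = begin
        Y + (ρ + ((1# + L) + (1# + L))) * X + (1# + L) * (ρ + L) * Z
          ≈⟨ solve 5 (λ x y z l p → y :+ (p :+ ((con 1 :+ l) :+ (con 1 :+ l))) :* x :+ (con 1 :+ l) :* (p :+ l) :* z
               := (y :+ (con 1 :+ l) :* x) :+ p :* (x :+ (con 1 :+ l) :* z) :+ (con 1 :+ l) :* (x :+ l :* z)) refl X Y Z L ρ ⟩
        (Y + (1# + L) * X) + ρ * (X + (1# + L) * Z) + (1# + L) * (X + L * Z)
          ≈⟨ +-cong (+-congʳ (falling-suc q (suc l))) (*-congˡ (falling-suc q l)) ⟩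
        Q * X + ρ * (X + (1# + L) * Z) + (1# + L) * (Q * Z)
          ≈⟨ solve 5 (λ x q z l p → q :* x :+ p :* (x :+ (con 1 :+ l) :* z) :+ (con 1 :+ l) :* (q :* z)
               := (p :+ q) :* (x :+ (con 1 :+ l) :* z)) refl X Q Z L ρ ⟩
        (ρ + Q) * (X + (1# + L) * Z)
          ≈⟨ *-congˡ (falling-pascal q l) ⟨
        (ρ + Q) * falling (suc q) (suc l) ∎
        where
        X = falling q (suc l)
        Y = falling q (suc (suc l))
        Z = falling q l
        L = ι l
        Q = ι q

      lower≈ : ∀ q l → v ^ l * (u ^ q * (falling q (suc l) * rising q)) ≈ μ-lower q l
      lower≈ zero    l = trans (*-congˡ (trans (*-congˡ (zeroˡ _)) (zeroʳ _))) (zeroʳ _)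
      lower≈ (suc q) l = solve 7 (λ V u U i f r p → V :* ((u :* U) :* ((i :* f) :* (r :* p)))
                                   := (i :* p :* u) :* (V :* (U :* (f :* r)))) refl
        (v ^ l) u (u ^ q) (ι (suc q)) (falling q l) (rising q) (ρ + ι q)

    -- One factor v = 1 + u of the superdiagonal term is split. Its part u completes the remaining
    -- terms to μ_(q+1), its part 1 is the multiple of μ_(q-1).
    A-μ : ∀ q l → A (μ q) l ≈ μ (suc q) l + μ-lower q l
    A-μ q zero = begin
      v * 1# * (U * (falling q 1 * r)) + ρ * u * (1# * (U * (1# * r)))
        ≈⟨ solve 5 (λ u U f r p →
             (con 1 :+ u) :* con 1 :* (U :* (f :* r)) :+ p :* u :* (con 1 :* (U :* (con 1 :* r)))
             := con 1 :* ((u :* U) :* (con 1 :* (r :* (p :+ f)))) :+ con 1 :* (U :* (f :* r)))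
             refl u U (falling q 1) r ρ ⟩
      1# * ((u * U) * (1# * (r * (ρ + falling q 1)))) + 1# * (U * (falling q 1 * r))
        ≈⟨ +-cong (*-congˡ (*-congˡ (*-congˡ (*-congˡ (+-congˡ (falling₁ q)))))) (lower≈ q zero) ⟩
      1# * ((u * U) * (1# * (r * (ρ + ι q)))) + μ-lower q zero ∎
      where
      U = u ^ q
      r = rising q
    A-μ q (suc l) = begin
      v * (v * V) * (U * (Y * r)) + β * u * (v * V * (U * (X * r))) + α * (u * v) * (V * (U * (Z * r)))
        ≈⟨ solve 9 (λ u V U r X Y Z b a →
             (con 1 :+ u) :* ((con 1 :+ u) :* V) :* (U :* (Y :* r))
               :+ b :* u :* ((con 1 :+ u) :* V :* (U :* (X :* r)))
               :+ a :* (u :* (con 1 :+ u)) :* (V :* (U :* (Z :* r)))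
             := (con 1 :+ u) :* V :* (u :* U :* ((Y :+ b :* X :+ a :* Z) :* r))
               :+ (con 1 :+ u) :* V :* (U :* (Y :* r)))
             refl u V U r X Y Z β α ⟩
      v * V * (u * U * ((Y + β * X + α * Z) * r)) + v * V * (U * (Y * r))
        ≈⟨ +-cong (*-congˡ (*-congˡ (trans (*-congʳ (falling-A q l))
             (solve 3 (λ p f r → p :* f :* r := f :* (r :* p)) refl (ρ + ι q) (falling (suc q) (suc l)) r))))
             (lower≈ q (suc l)) ⟩
      v * V * (u * U * (falling (suc q) (suc l) * (r * (ρ + ι q)))) + μ-lower q (suc l) ∎
      where
      V = v ^ l
      U = u ^ q
      r = rising q
      X = falling q (suc l)
      Y = falling q (suc (suc l))
      Z = falling q l
      β = ρ + (ι (suc l) + ι (suc l))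
      α = ι (suc l) * (ρ + ι l)

    private
      A-scale : ∀ a {x z} → (∀ l → z l ≈ a * x l) → ∀ l → A z l ≈ a * A x l
      A-scale a z≈ l = trans (A-linear a {y = λ _ → 0#} (λ l → trans (z≈ l) (sym (+-identityʳ _))) l)
        (trans (+-congˡ (A-0 (λ _ → refl) l)) (+-identityʳ _))

      μ-even : ℕ → ℕ → Carrier
      μ-even k = μ (2 ℕ.* k)

      2*suc : ∀ k (x : ℕ → ℕ → Carrier) l → x (2 ℕ.* suc k) l ≈ x (suc (suc (2 ℕ.* k))) l
      2*suc k x l = reflexive (≡.cong (λ q → x q l) (ℕ.*-suc 2 k))

      A-lower-Span : ∀ k → Span μ-even (suc k) (A (μ-lower (2 ℕ.* k)))
      A-lower-Span zero    = none (A-0 λ _ → refl)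
      A-lower-Span (suc k) = Span-+
        (Span-∙ κ (ℕ.n<1+n (suc k)) λ l → *-congˡ {κ} (sym (2*suc k μ l)))
        (Span-∙ (κ * κ′) (ℕ.m<n⇒m<1+n (ℕ.n<1+n k)) λ l → sym (*-assoc κ κ′ _))
        λ l → begin
          A (μ-lower (2 ℕ.* suc k)) l              ≈⟨ 2*suc k (A ∘ μ-lower) l ⟩
          A (μ-lower (suc (suc q))) l              ≈⟨ A-scale κ (λ _ → refl) l ⟩
          κ * A (μ (suc q)) l                      ≈⟨ *-congˡ (A-μ (suc q) l) ⟩
          κ * (μ (suc (suc q)) l + κ′ * μ q l)     ≈⟨ distribˡ κ _ _ ⟩
          κ * μ (suc (suc q)) l + κ * (κ′ * μ q l) ∎
        where
        q  = 2 ℕ.* k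
        κ  = ι (suc (suc q)) * (ρ + ι (suc q)) * u
        κ′ = ι (suc q) * (ρ + ι q) * u

      -- From q = 2k, two steps reach only q + 2, q and q - 2. The lower part of the first step is
      -- itself a multiple of the odd μ_(q-1), which `A` sends back to even indices.
      A²-μ-even : ∀ k → Monic μ-even (suc k) (A (A (μ-even k)))
      A²-μ-even k = _ , Span-+ (Span-∙ κ (ℕ.n<1+n k) (λ _ → refl)) (A-lower-Span k) (λ _ → refl) , λ l → begin
        A (A (μ q)) l
          ≈⟨ A-linear 1# (λ l → trans (A-μ q l) (+-congʳ (sym (*-identityˡ _)))) l ⟩
        1# * A (μ (suc q)) l + A (μ-lower q) l
          ≈⟨ +-congʳ (trans (*-identityˡ _) (A-μ (suc q) l)) ⟩
        (μ (suc (suc q)) l + κ * μ q l) + A (μ-lower q) l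
          ≈⟨ +-assoc _ _ _ ⟩
        μ (suc (suc q)) l + (κ * μ q l + A (μ-lower q) l)
          ≈⟨ +-congʳ (2*suc k μ l) ⟨
        μ (2 ℕ.* suc k) l + (κ * μ q l + A (μ-lower q) l) ∎
        where
        q = 2 ℕ.* k
        κ = ι (suc q) * (ρ + ι q) * u

    -- Here `s k l` stands for the k-th derivative of S_l at 0, so the initial row is δ₀.
    module _
      (s : ℕ → ℕ → Carrier)
      (s₀₀ : s 0 0 ≈ 1#) (s₀ : ∀ l → s 0 (suc l) ≈ 0#)
      (s-suc₀ : ∀ k → s (suc k) 0 ≈ ρ * t * s k 0 + ρ * v * s k 1)
      (s-suc : ∀ k l → s (suc k) (suc l) ≈
        ι (suc l) * s k l + (ρ + (ι (suc l) + ι (suc l))) * t * s k (suc l) + (ρ + ι (suc l)) * v * s k (suc (suc l)))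
      where

      private
        -- With these powers of t, the recurrence of s becomes one in t² alone.
        ε : ℕ → ℕ → Carrier
        ε k l = t ^ k * (t ^ l * (v ^ l * (rising l * s k l)))

        ε₀ : ∀ l → ε 0 l ≈ μ 0 l
        ε₀ zero    = *-congˡ (*-congˡ (*-congˡ (trans (*-congˡ s₀₀) (*-identityʳ _))))
        ε₀ (suc l) = trans (*-congˡ (trans (*-congˡ (trans (*-congˡ (trans (*-congˡ (s₀ l)) (zeroʳ _))) (zeroʳ _))) (zeroʳ _)))
          (trans (*-identityˡ _) (sym (trans (*-congˡ (trans (*-congˡ (zeroˡ _)) (zeroʳ _))) (zeroʳ _))))

        -- The weight v^l `rising l` absorbs the factor (ρ + l) v, and t^l absorbs the new factor t,
        -- so that the superdiagonal becomes 1. This is what makes the column operations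
        -- unitriangular.
        ε-suc : ∀ k l → ε (suc k) l ≈ A (ε k) l
        ε-suc k zero = trans (*-congˡ (*-congˡ (*-congˡ (*-congˡ (s-suc₀ k)))))
          (solve 5 (λ t T p s s′ →
             t :* T :* (con 1 :* (con 1 :* (con 1 :* (p :* t :* s :+ p :* (con 1 :+ t :* t) :* s′))))
             := T :* (t :* con 1 :* ((con 1 :+ t :* t) :* con 1 :* (con 1 :* (p :+ con 0) :* s′)))
                :+ p :* (t :* t) :* (T :* (con 1 :* (con 1 :* (con 1 :* s)))))
             refl t (t ^ k) ρ (s k 0) (s k 1))
        ε-suc k (suc l) = trans (*-congˡ (*-congˡ (*-congˡ (*-congˡ (s-suc k l)))))
          (solve 10 (λ t T U V r p i s s′ s″ →
             let v = con 1 :+ t :* t ; j = con 1 :+ i in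
             t :* T :* (t :* U :* (v :* V :* (r :* (p :+ i) :* (j :* s :+ (p :+ (j :+ j)) :* t :* s′ :+ (p :+ j) :* v :* s″))))
             := T :* (t :* (t :* U) :* (v :* (v :* V) :* (r :* (p :+ i) :* (p :+ j) :* s″)))
                :+ (p :+ (j :+ j)) :* (t :* t) :* (T :* (t :* U :* (v :* V :* (r :* (p :+ i) :* s′))))
                :+ j :* (p :+ i) :* (t :* t :* v) :* (T :* (U :* (V :* (r :* s)))))
             refl t (t ^ k) (t ^ l) (v ^ l) (rising l) ρ (ι l) (s k l) (s k (suc l)) (s k (suc (suc l))))

        ε-even-monic : ∀ i → Monic μ-even i (ε (2 ℕ.* i))
        ε-even-monic zero    = (λ _ → 0#) , none (λ _ → refl) , λ l → trans (ε₀ l) (sym (+-identityʳ _))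
        ε-even-monic (suc i) = Monic-resp
          (Monic-suc (A ∘ A) (A-0 ∘ A-0) (λ a z≈ → A-linear a (A-linear a z≈)) A²-μ-even (ε-even-monic i))
          λ l → trans (2*suc i ε l) (trans (ε-suc (suc (2 ℕ.* i)) l) (A-cong (ε-suc (2 ℕ.* i)) l))
          where
          A-cong : ∀ {x y} → (∀ l → y l ≈ x l) → ∀ l → A y l ≈ A x l
          A-cong y≈x l = trans (A-scale 1# (λ l → trans (y≈x l) (sym (*-identityˡ _))) l) (*-identityˡ _)

        ε-column : ℕ → ℕ → Carrier
        ε-column l k = ε k l

        -- The same recurrence read with l fixed: shifting column l in k gives column l + 1 plus
        -- multiples of columns l and l - 1. Iterated from column 0 this expresses the Hankel
        -- columns.
        shift-monic : ∀ l → Monic ε-column (suc l) (ε-column l ∘ suc)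
        shift-monic zero    = _ , Span-∙ (ρ * u) (ℕ.n<1+n 0) (λ _ → refl) , λ k → ε-suc k 0
        shift-monic (suc l) = _
          , Span-+ (Span-∙ _ (ℕ.n<1+n (suc l)) (λ _ → refl)) (Span-∙ _ (ℕ.m<n⇒m<1+n (ℕ.n<1+n l)) (λ _ → refl)) (λ _ → refl)
          , λ k → trans (ε-suc k (suc l)) (+-assoc _ _ _)

        y-monic : ∀ j → Monic ε-column j (λ k → ε (k ℕ.+ j) 0)
        y-monic zero    = (λ _ → 0#) , none (λ _ → refl) ,
          λ k → trans (reflexive (≡.cong (λ m → ε m 0) (ℕ.+-identityʳ k))) (sym (+-identityʳ _))
        y-monic (suc j) = Monic-resp
          (Monic-suc (_∘ suc) (_∘ suc) (λ _ → _∘ suc) shift-monic (y-monic j))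
          λ k → reflexive (≡.cong (λ m → ε m 0) (ℕ.+-suc k j))

      det-dilated : ∀ n →
        (t ^ 2) ^ (n C 2) * (t ^ (n C 2) * det n (λ i j → s (2 ℕ.* toℕ i ℕ.+ toℕ j) 0)) ≈
        v ^ (n C 2) * ((u ^ 2) ^ (n C 2) * det n (λ i j → rising (2 ℕ.* toℕ i ℕ.+ toℕ j)))
      det-dilated n = begin
        (t ^ 2) ^ N * (t ^ N * det n (λ i j → a i j))
          ≈⟨ *-congˡ (det-scale-columns n t a) ⟨
        (t ^ 2) ^ N * det n (λ i j → t ^ toℕ j * a i j)
          ≈⟨ det-scale-rows n (t ^ 2) (λ i j → t ^ toℕ j * a i j) ⟨
        det n (λ i j → (t ^ 2) ^ toℕ i * (t ^ toℕ j * a i j))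
          ≈⟨ det-cong n (λ i j → unscale (toℕ i) (toℕ j)) ⟩
        det n (λ i j → ε (2 ℕ.* toℕ i ℕ.+ toℕ j) 0)
          -- The column relations hold for every k, hence also for the even k that the dilation
          -- selects.
          ≈⟨ det-unitriangularʳ n (λ l i → ε (2 ℕ.* toℕ i) l) (λ j i → ε (2 ℕ.* toℕ i ℕ.+ j) 0)
               (λ j → Monic-∘ (λ i → 2 ℕ.* toℕ i) (y-monic j)) ⟩
        det n (λ i j → ε (2 ℕ.* toℕ i) (toℕ j))
          ≈⟨ det-unitriangularˡ n (λ k j → μ-even k (toℕ j)) (λ i j → ε (2 ℕ.* i) (toℕ j))
               (λ i → Monic-∘ toℕ (ε-even-monic i)) ⟩
        det n (λ i j → v ^ toℕ j * (u ^ (2 ℕ.* toℕ i) * b i j))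
          ≈⟨ det-scale-columns n v (λ i j → u ^ (2 ℕ.* toℕ i) * b i j) ⟩
        v ^ N * det n (λ i j → u ^ (2 ℕ.* toℕ i) * b i j)
          ≈⟨ *-congˡ (det-cong n λ i j → *-congʳ (sym (^-assocʳ u 2 (toℕ i)))) ⟩
        v ^ N * det n (λ i j → (u ^ 2) ^ toℕ i * b i j)
          ≈⟨ *-congˡ (det-scale-rows n (u ^ 2) b) ⟩
        v ^ N * ((u ^ 2) ^ N * det n b)
          ≈⟨ *-congˡ (*-congˡ (det-rising n)) ⟨
        v ^ N * ((u ^ 2) ^ N * det n (λ i j → rising (2 ℕ.* toℕ i ℕ.+ toℕ j))) ∎
        where
        N = n C 2

        a b : Matrix n
        a i j = s (2 ℕ.* toℕ i ℕ.+ toℕ j) 0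
        b i j = falling (2 ℕ.* toℕ i) (toℕ j) * rising (2 ℕ.* toℕ i)

        unscale : ∀ i j → (t ^ 2) ^ i * (t ^ j * s (2 ℕ.* i ℕ.+ j) 0) ≈ ε (2 ℕ.* i ℕ.+ j) 0
        unscale i j = begin
          (t ^ 2) ^ i * (t ^ j * s (2 ℕ.* i ℕ.+ j) 0)
            ≈⟨ *-assoc _ _ _ ⟨
          (t ^ 2) ^ i * t ^ j * s (2 ℕ.* i ℕ.+ j) 0
            ≈⟨ *-congʳ (trans (*-congʳ (^-assocʳ t 2 i)) (sym (^-homo-* t (2 ℕ.* i) j))) ⟩
          t ^ (2 ℕ.* i ℕ.+ j) * s (2 ℕ.* i ℕ.+ j) 0
            ≈⟨ *-congˡ (trans (*-identityˡ _) (trans (*-identityˡ _) (*-identityˡ _))) ⟨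
          ε (2 ℕ.* i ℕ.+ j) 0 ∎

      det-dilated-cancelled : (∀ {x y} → t * x ≈ t * y → x ≈ y) → ∀ n →
        det n (λ i j → s (2 ℕ.* toℕ i ℕ.+ toℕ j) 0) ≈
        (t * v) ^ (n C 2) * det n (λ i j → rising (2 ℕ.* toℕ i ℕ.+ toℕ j))
      det-dilated-cancelled cancel n = ^-cancel N (^-cancel N (^-cancel N (begin
        T * (T * (T * Ha))
          ≈⟨ solve 2 (λ T h → T :* (T :* (T :* h)) := T :* T :* (T :* h)) refl T Ha ⟩
        T * T * (T * Ha)
          ≈⟨ *-congʳ t²^N ⟨
        (t ^ 2) ^ N * (T * Ha)
          ≈⟨ det-dilated n ⟩
        v ^ N * ((u ^ 2) ^ N * Hb)
          ≈⟨ *-congˡ (*-congʳ u²^N) ⟩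
        v ^ N * (T * T * (T * T) * Hb)
          ≈⟨ solve 3 (λ T V h → V :* (T :* T :* (T :* T) :* h) := T :* (T :* (T :* (T :* V :* h)))) refl T (v ^ N) Hb ⟩
        T * (T * (T * (T * v ^ N * Hb)))
          ≈⟨ *-congˡ (*-congˡ (*-congˡ (*-congʳ (^-distrib-* t v N)))) ⟨
        T * (T * (T * ((t * v) ^ N * Hb))) ∎)))
        where
        N  = n C 2
        T  = t ^ N
        Ha = det n (λ i j → s (2 ℕ.* toℕ i ℕ.+ toℕ j) 0)
        Hb = det n (λ i j → rising (2 ℕ.* toℕ i ℕ.+ toℕ j))

        square : ∀ x → (x ^ 2) ^ N ≈ x ^ N * x ^ N
        square x = trans (^-congˡ N (*-congˡ (*-identityʳ x))) (^-distrib-* x x N)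

        t²^N : (t ^ 2) ^ N ≈ T * T
        t²^N = square t

        u²^N : (u ^ 2) ^ N ≈ T * T * (T * T)
        u²^N = trans (square u) (*-cong (^-distrib-* t t N) (^-distrib-* t t N))

        ^-cancel : ∀ m {x y} → t ^ m * x ≈ t ^ m * y → x ≈ y
        ^-cancel zero    eq = trans (sym (*-identityˡ _)) (trans eq (*-identityˡ _))
        ^-cancel (suc m) eq = ^-cancel m (cancel (trans (sym (*-assoc _ _ _)) (trans eq (*-assoc _ _ _))))

-- Derivations, and the derivatives of S_l in a differential ring.

record IsDerivation {c ℓ} (K : CommutativeRing c ℓ)
  (D : CommutativeRing.Carrier K → CommutativeRing.Carrier K) : Set (c ⊔ ℓ) where
  open CommutativeRing K
  field
    D-cong : ∀ {x y} → x ≈ y → D x ≈ D y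
    D-+    : ∀ x y → D (x + y) ≈ D x + D y
    D-*    : ∀ x y → D (x * y) ≈ D x * y + x * D y

module Derivation {c ℓ} (K : CommutativeRing c ℓ) {D : CommutativeRing.Carrier K → CommutativeRing.Carrier K}
  (D-isDerivation : IsDerivation K D) where

  open IsDerivation D-isDerivation
  open CommutativeRing K hiding (zero)
  open Algebra.Definitions.RawSemiring (RawRing.rawSemiring rawRing) using (_^_; _×_)
  open Algebra.Properties.AbelianGroup +-abelianGroup using (∙-cancelʳ; identityˡ-unique)
  open Algebra.Properties.Semiring.Exp semiring using (^-congˡ)
  open Algebra.Properties.CommutativeSemiring.Exp commutativeSemiring using (^-distrib-*)
  open Algebra.Solver.Ring.NaturalCoefficients.Default commutativeSemiring using (solve; _:=_; _:+_; _:*_; con)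
  open Relation.Binary.Reasoning.Setoid setoid

  D-1 : D 1# ≈ 0#
  D-1 = identityˡ-unique (D 1#) (D 1#) (begin
    D 1# + D 1#                ≈⟨ +-cong (*-identityʳ _) (*-identityˡ _) ⟨
    D 1# * 1# + 1# * D 1#      ≈⟨ D-* 1# 1# ⟨
    D (1# * 1#)                ≈⟨ D-cong (*-identityˡ 1#) ⟩
    D 1#                       ∎)

  -- With the logarithmic derivative `g` given, the power on the right keeps the exponent n and no
  -- predecessor of n appears.
  D-^ : ∀ {x g} → D x ≈ x * g → ∀ n → D (x ^ n) ≈ (n × 1#) * (x ^ n * g)
  D-^ {x} {g} Dx zero    = trans D-1 (sym (zeroˡ _))
  D-^ {x} {g} Dx (suc n) = begin
    D (x * x ^ n)
      ≈⟨ D-* x (x ^ n) ⟩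
    D x * x ^ n + x * D (x ^ n)
      ≈⟨ +-cong (*-congʳ Dx) (*-congˡ (D-^ Dx n)) ⟩
    x * g * x ^ n + x * ((n × 1#) * (x ^ n * g))
      ≈⟨ solve 4 (λ x g X n → x :* g :* X :+ x :* (n :* (X :* g)) := (con 1 :+ n) :* (x :* X :* g))
           refl x g (x ^ n) (n × 1#) ⟩
    (1# + n × 1#) * (x * x ^ n * g) ∎

  inverse-unique : ∀ {h x y} → h * x ≈ 1# → h * y ≈ 1# → x ≈ y
  inverse-unique {h} {x} {y} hx≈1 hy≈1 = begin
    x              ≈⟨ *-identityˡ x ⟨
    1# * x         ≈⟨ *-congʳ hy≈1 ⟨
    h * y * x      ≈⟨ solve 3 (λ h x y → h :* y :* x := h :* x :* y) refl h x y ⟩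
    h * x * y      ≈⟨ *-congʳ hx≈1 ⟩
    1# * y         ≈⟨ *-identityˡ y ⟩
    y              ∎

  inverse-^ : ∀ {h p f} n → h * p ≈ 1# → h ^ n * f ≈ 1# → f ≈ p ^ n
  inverse-^ {h} {p} n hp≈1 hⁿf≈1 = inverse-unique hⁿf≈1 (trans (sym (^-distrib-* h p n)) (trans (^-congˡ n hp≈1) (1^ n)))
    where
    1^ : ∀ n → 1# ^ n ≈ 1#
    1^ zero    = refl
    1^ (suc n) = trans (*-identityˡ _) (1^ n)

  -- Differentiate h p = 1. The element `w` is -D h, introduced by an equation to keep the
  -- computation free of subtraction.
  D-inverse : ∀ {h p w} → h * p ≈ 1# → D h + w ≈ 0# → D p ≈ p * (p * w)
  D-inverse {h} {p} {w} hp≈1 Dh+w≈0 = begin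
    D p                ≈⟨ *-identityˡ _ ⟨
    1# * D p           ≈⟨ *-congʳ hp≈1 ⟨
    h * p * D p        ≈⟨ solve 3 (λ h p d → h :* p :* d := p :* (h :* d)) refl h p (D p) ⟩
    p * (h * D p)      ≈⟨ *-congˡ (∙-cancelʳ (D h * p) (h * D p) (p * w) (begin
      h * D p + D h * p  ≈⟨ +-comm _ _ ⟩
      D h * p + h * D p  ≈⟨ D-* h p ⟨
      D (h * p)          ≈⟨ D-cong hp≈1 ⟩
      D 1#               ≈⟨ D-1 ⟩
      0#                 ≈⟨ zeroʳ p ⟨
      p * 0#             ≈⟨ *-congˡ Dh+w≈0 ⟨
      p * (D h + w)      ≈⟨ solve 3 (λ p d w → p :* (d :+ w) := p :* w :+ d :* p) refl p (D h) w ⟩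
      p * w + D h * p    ∎)) ⟩
    p * (p * w)        ∎

  module Trigonometric {cos sin τ h p : Carrier}
    (D-sin : D sin ≈ cos) (D-cos : D cos + sin ≈ 0#) (D-τ : D τ ≈ 0#)
    (h≈ : h + τ * sin ≈ cos) (hp≈1 : h * p ≈ 1#) (r : ℕ)
    where

    private
      υ = 1# + τ * τ
      ρ = r × 1#

    σ : Carrier
    σ = sin * p

    S : ℕ → Carrier
    S l = σ ^ l * p ^ r

    private
      -- Replacing the cosine by h + τ sin in h′ = -sin - τ cos leaves sin with the coefficient 1 +
      -- τ², the source of the factor 1 + t² in the theorem.
      D-h : D h + (τ * h + υ * sin) ≈ 0#
      D-h = begin
        D h + (τ * h + (1# + τ * τ) * sin)
          ≈⟨ solve 4 (λ d t h s → d :+ (t :* h :+ (con 1 :+ t :* t) :* s) := (d :+ t :* (h :+ t :* s)) :+ s)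
               refl (D h) τ h sin ⟩
        (D h + τ * (h + τ * sin)) + sin
          ≈⟨ +-congʳ (+-congˡ (*-congˡ (trans h≈ (sym D-sin)))) ⟩
        (D h + τ * D sin) + sin
          ≈⟨ +-congʳ (+-congˡ (trans (+-congʳ (trans (*-congʳ D-τ) (zeroˡ sin))) (+-identityˡ _))) ⟨
        (D h + (D τ * sin + τ * D sin)) + sin
          ≈⟨ +-congʳ (+-congˡ (D-* τ sin)) ⟨
        (D h + D (τ * sin)) + sin
          ≈⟨ +-congʳ (D-+ h (τ * sin)) ⟨
        D (h + τ * sin) + sin
          ≈⟨ +-congʳ (D-cong h≈) ⟩
        D cos + sin
          ≈⟨ D-cos ⟩
        0# ∎

      D-p : D p ≈ p * (τ + υ * σ)
      D-p = begin
        D p                                      ≈⟨ D-inverse hp≈1 D-h ⟩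
        p * (p * (τ * h + υ * sin))              ≈⟨ solve 5 (λ p t h y s →
                                                      p :* (p :* (t :* h :+ y :* s)) := p :* (t :* (h :* p) :+ y :* (s :* p)))
                                                      refl p τ h υ sin ⟩
        p * (τ * (h * p) + υ * (sin * p))        ≈⟨ *-congˡ (+-congʳ (trans (*-congˡ hp≈1) (*-identityʳ τ))) ⟩
        p * (τ + υ * (sin * p))                  ∎

      -- A Riccati equation for sin / h: its three terms are the origin of the three terms in the
      -- recurrence of S_l, hence of the tridiagonal form.
      D-σ : D σ ≈ 1# + (τ + τ) * σ + υ * σ * σ
      D-σ = begin
        D (sin * p)
          ≈⟨ D-* sin p ⟩
        D sin * p + sin * D p
          ≈⟨ +-cong (*-congʳ (trans D-sin (sym h≈))) (*-congˡ D-p) ⟩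
        (h + τ * sin) * p + sin * (p * (τ + υ * (sin * p)))
          ≈⟨ solve 5 (λ p t h y s → (h :+ t :* s) :* p :+ s :* (p :* (t :+ y :* (s :* p)))
               := h :* p :+ (t :+ t) :* (s :* p) :+ y :* (s :* p) :* (s :* p)) refl p τ h υ sin ⟩
        h * p + (τ + τ) * (sin * p) + υ * (sin * p) * (sin * p)
          ≈⟨ +-congʳ (+-congʳ hp≈1) ⟩
        1# + (τ + τ) * (sin * p) + υ * (sin * p) * (sin * p) ∎

    D-S₀ : D (S 0) ≈ ρ * τ * S 0 + ρ * υ * S 1
    D-S₀ = begin
      D (1# * p ^ r)                 ≈⟨ D-cong (*-identityˡ _) ⟩
      D (p ^ r)                      ≈⟨ D-^ D-p r ⟩
      ρ * (p ^ r * (τ + υ * σ))      ≈⟨ solve 5 (λ r P t y s → r :* (P :* (t :+ y :* s))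
                                          := r :* t :* (con 1 :* P) :+ r :* y :* (s :* con 1 :* P)) refl ρ (p ^ r) τ υ σ ⟩
      ρ * τ * S 0 + ρ * υ * S 1      ∎

    D-S : ∀ l → let ι = suc l × 1# in
      D (S (suc l)) ≈ ι * S l + (ρ + (ι + ι)) * τ * S (suc l) + (ρ + ι) * υ * S (suc (suc l))
    D-S l = begin
      D (σ * σ ^ l * p ^ r)
        ≈⟨ trans (D-cong (*-assoc _ _ _)) (D-* σ (S l)) ⟩
      D σ * S l + σ * D (S l)
        ≈⟨ +-cong (*-congʳ D-σ) (rest l) ⟩
      (1# + (τ + τ) * σ + υ * σ * σ) * S l + (ι * S l + (ρ + (ι + ι)) * τ * (σ * S l) + (ρ + ι) * υ * (σ * (σ * S l)))
        ≈⟨ solve 7 (λ t y s X P n r →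
             let S = X :* P ; m = con 1 :+ n in
             (con 1 :+ (t :+ t) :* s :+ y :* s :* s) :* S
               :+ (n :* S :+ (r :+ (n :+ n)) :* t :* (s :* S) :+ (r :+ n) :* y :* (s :* (s :* S)))
             := m :* S :+ (r :+ (m :+ m)) :* t :* (s :* X :* P) :+ (r :+ m) :* y :* (s :* (s :* X) :* P))
             refl τ υ σ (σ ^ l) (p ^ r) ι ρ ⟩
      (1# + ι) * S l + (ρ + ((1# + ι) + (1# + ι))) * τ * S (suc l) + (ρ + (1# + ι)) * υ * S (suc (suc l)) ∎
      where
      ι = l × 1#

      -- Multiplication by σ turns l S_(l-1) into l S_l, so the formula also covers l = 0. It
      -- alternates with `D-S` in the induction.
      rest : ∀ l → let ι = l × 1# in
        σ * D (S l) ≈ ι * S l + (ρ + (ι + ι)) * τ * (σ * S l) + (ρ + ι) * υ * (σ * (σ * S l))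
      rest zero = begin
        σ * D (S 0)
          ≈⟨ *-congˡ D-S₀ ⟩
        σ * (ρ * τ * S 0 + ρ * υ * S 1)
          ≈⟨ solve 5 (λ r t y s P → s :* (r :* t :* (con 1 :* P) :+ r :* y :* (s :* con 1 :* P))
               := con 0 :* (con 1 :* P) :+ (r :+ (con 0 :+ con 0)) :* t :* (s :* (con 1 :* P))
                  :+ (r :+ con 0) :* y :* (s :* (s :* (con 1 :* P)))) refl ρ τ υ σ (p ^ r) ⟩
        0# * S 0 + (ρ + (0# + 0#)) * τ * (σ * S 0) + (ρ + 0#) * υ * (σ * (σ * S 0)) ∎
      rest (suc l) = begin
        σ * D (S (suc l))
          ≈⟨ *-congˡ (D-S l) ⟩
        σ * (m * S l + (ρ + (m + m)) * τ * S (suc l) + (ρ + m) * υ * S (suc (suc l)))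
          ≈⟨ solve 7 (λ t y s X P m r →
               s :* (m :* (X :* P) :+ (r :+ (m :+ m)) :* t :* (s :* X :* P) :+ (r :+ m) :* y :* (s :* (s :* X) :* P))
               := m :* (s :* X :* P) :+ (r :+ (m :+ m)) :* t :* (s :* (s :* X :* P))
                  :+ (r :+ m) :* y :* (s :* (s :* (s :* X :* P)))) refl τ υ σ (σ ^ l) (p ^ r) m ρ ⟩
        m * S (suc l) + (ρ + (m + m)) * τ * (σ * S (suc l)) + (ρ + m) * υ * (σ * (σ * S (suc l))) ∎
        where m = suc l × 1#

-- Exponential coefficients as a differential ring.

-- Hurwitz series: f stands for Σ f k xᵏ / k!, so that differentiation is the shift.
module Hurwitz {c ℓ} (R : CommutativeRing c ℓ) where

  open CommutativeRing R hiding (zero)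
  open Algebra.Definitions.RawSemiring (RawRing.rawSemiring rawRing) using (_×_)
  open Algebra.Properties.Monoid.Mult +-monoid using (×-congʳ; ×-congˡ; ×-assocˡ)
  open Algebra.Properties.CommutativeMonoid.Mult +-commutativeMonoid using (×-distrib-+)
  open Algebra.Properties.Semiring.Mult semiring using (×-comm-*)
  open Algebra.Properties.Semiring.Sum semiring using (sum-cong-≋)
  open Algebra.Properties.CommutativeMonoid.Sum +-commutativeMonoid using (∑-distrib-+)
  open Algebra.Solver.Ring.NaturalCoefficients.Default commutativeSemiring using (solve; _:=_; _:+_; _:*_; con)
  open Relation.Binary.Reasoning.Setoid setoid
  open PowerSeries R

  infixl 7 _⋆_

  shift : Series → Series
  shift f k = f (suc k)

  -- The product is defined by the Leibniz rule, so that `shift` is a derivation by definition and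
  -- binomial coefficients never appear.
  _⋆_ : Series → Series → Series
  (f ⋆ g) zero    = f 0 * g 0
  (f ⋆ g) (suc k) = (shift f ⋆ g) k + (f ⋆ shift g) k

  private
    shift-cong : ∀ {f g} → f ≈ₛ g → shift f ≈ₛ shift g
    shift-cong e = mk≈ₛ (at e ∘ suc)

    ⋆-cong : ∀ {f f′ g g′} → f ≈ₛ f′ → g ≈ₛ g′ → f ⋆ g ≈ₛ f′ ⋆ g′
    ⋆-cong e e′ = mk≈ₛ (go e e′)
      where
      go : ∀ {f f′ g g′} → f ≈ₛ f′ → g ≈ₛ g′ → ∀ k → (f ⋆ g) k ≈ (f′ ⋆ g′) k
      go e e′ zero    = *-cong (at e 0) (at e′ 0)
      go e e′ (suc k) = +-cong (go (shift-cong e) e′ k) (go e (shift-cong e′) k)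

    ⋆-comm : ∀ f g k → (f ⋆ g) k ≈ (g ⋆ f) k
    ⋆-comm f g zero    = *-comm _ _
    ⋆-comm f g (suc k) = trans (+-cong (⋆-comm (shift f) g k) (⋆-comm f (shift g) k)) (+-comm _ _)

    interchange : ∀ a b c d → (a + b) + (c + d) ≈ (a + c) + (b + d)
    interchange = solve 4 (λ a b c d → (a :+ b) :+ (c :+ d) := (a :+ c) :+ (b :+ d)) refl

    ⋆-distribʳ : ∀ h f g k → ((f +ₛ g) ⋆ h) k ≈ (f ⋆ h) k + (g ⋆ h) k
    ⋆-distribʳ h f g zero    = distribʳ _ _ _
    ⋆-distribʳ h f g (suc k) = trans
      (+-cong (⋆-distribʳ h (shift f) (shift g) k) (⋆-distribʳ (shift h) f g k)) (interchange _ _ _ _)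

    ⋆-distribˡ : ∀ h f g k → (h ⋆ (f +ₛ g)) k ≈ (h ⋆ f) k + (h ⋆ g) k
    ⋆-distribˡ h f g k = trans (⋆-comm h (f +ₛ g) k)
      (trans (⋆-distribʳ h f g k) (+-cong (⋆-comm f h k) (⋆-comm g h k)))

    ⋆-assoc : ∀ f g h k → ((f ⋆ g) ⋆ h) k ≈ (f ⋆ (g ⋆ h)) k
    ⋆-assoc f g h zero    = *-assoc _ _ _
    ⋆-assoc f g h (suc k) = begin
      ((shift f ⋆ g +ₛ f ⋆ shift g) ⋆ h) k + ((f ⋆ g) ⋆ shift h) k
        ≈⟨ +-congʳ (⋆-distribʳ h (shift f ⋆ g) (f ⋆ shift g) k) ⟩
      (((shift f ⋆ g) ⋆ h) k + ((f ⋆ shift g) ⋆ h) k) + ((f ⋆ g) ⋆ shift h) k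
        ≈⟨ +-cong (+-cong (⋆-assoc (shift f) g h k) (⋆-assoc f (shift g) h k)) (⋆-assoc f g (shift h) k) ⟩
      ((shift f ⋆ (g ⋆ h)) k + (f ⋆ (shift g ⋆ h)) k) + (f ⋆ (g ⋆ shift h)) k
        ≈⟨ +-assoc _ _ _ ⟩
      (shift f ⋆ (g ⋆ h)) k + ((f ⋆ (shift g ⋆ h)) k + (f ⋆ (g ⋆ shift h)) k)
        ≈⟨ +-congˡ (⋆-distribˡ f (shift g ⋆ h) (g ⋆ shift h) k) ⟨
      (shift f ⋆ (g ⋆ h)) k + (f ⋆ (shift g ⋆ h +ₛ g ⋆ shift h)) k ∎

    zero-⋆ : ∀ f g → (∀ k → f k ≈ 0#) → ∀ k → (f ⋆ g) k ≈ 0#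
    zero-⋆ f g f≈0 zero    = trans (*-congʳ (f≈0 0)) (zeroˡ _)
    zero-⋆ f g f≈0 (suc k) = trans
      (+-cong (zero-⋆ (shift f) g (f≈0 ∘ suc) k) (zero-⋆ f (shift g) f≈0 k)) (+-identityˡ _)

  scalar-⋆ : ∀ a f k → (scalar a ⋆ f) k ≈ a * f k
  scalar-⋆ a f zero    = refl
  scalar-⋆ a f (suc k) = trans
    (+-cong (zero-⋆ (shift (scalar a)) f (λ _ → refl) k) (scalar-⋆ a (shift f) k)) (+-identityˡ _)

  0ₛ≈0 : ∀ k → 0ₛ k ≈ 0#
  0ₛ≈0 zero    = refl
  0ₛ≈0 (suc k) = refl

  hurwitzIsCommutativeRing : IsCommutativeRing _≈ₛ_ _+ₛ_ _⋆_ -ₛ_ 0ₛ 1ₛ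
  hurwitzIsCommutativeRing = record
    { isRing = record
      { +-isAbelianGroup = record
        { isGroup = record
          { isMonoid = record
            { isSemigroup = record
              { isMagma = record
                { isEquivalence = record
                  { refl  = mk≈ₛ λ _ → refl
                  ; sym   = λ e → mk≈ₛ λ k → sym (at e k)
                  ; trans = λ e e′ → mk≈ₛ λ k → trans (at e k) (at e′ k)
                  }
                ; ∙-cong = λ e e′ → mk≈ₛ λ k → +-cong (at e k) (at e′ k)
                }
              ; assoc = λ f g h → mk≈ₛ λ k → +-assoc _ _ _
              }
            ; identity = (λ f → mk≈ₛ λ k → trans (+-congʳ (0ₛ≈0 k)) (+-identityˡ _))
                       , (λ f → mk≈ₛ λ k → trans (+-congˡ (0ₛ≈0 k)) (+-identityʳ _))
            }
          ; inverse = (λ f → mk≈ₛ λ k → trans (-‿inverseˡ _) (sym (0ₛ≈0 k)))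
                    , (λ f → mk≈ₛ λ k → trans (-‿inverseʳ _) (sym (0ₛ≈0 k)))
          ; ⁻¹-cong = λ e → mk≈ₛ λ k → -‿cong (at e k)
          }
        ; comm = λ f g → mk≈ₛ λ k → +-comm _ _
        }
      ; *-cong     = ⋆-cong
      ; *-assoc    = λ f g h → mk≈ₛ (⋆-assoc f g h)
      ; *-identity = (λ f → mk≈ₛ λ k → trans (scalar-⋆ 1# f k) (*-identityˡ _))
                   , (λ f → mk≈ₛ λ k → trans (⋆-comm f 1ₛ k) (trans (scalar-⋆ 1# f k) (*-identityˡ _)))
      ; distrib    = (λ h f g → mk≈ₛ (⋆-distribˡ h f g)) , (λ h f g → mk≈ₛ (⋆-distribʳ h f g))
      }
    ; *-comm = λ f g → mk≈ₛ (⋆-comm f g)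
    }

  hurwitzRing : CommutativeRing c ℓ
  hurwitzRing = record { isCommutativeRing = hurwitzIsCommutativeRing }

  module H where
    open CommutativeRing hurwitzRing public
    open Algebra.Definitions.RawSemiring (RawRing.rawSemiring (CommutativeRing.rawRing hurwitzRing)) public using (_^_) renaming (_×_ to _×ᴴ_)

  shift-isDerivation : IsDerivation hurwitzRing shift
  shift-isDerivation = record
    { D-cong = shift-cong
    ; D-+    = λ _ _ → mk≈ₛ λ _ → refl
    ; D-*    = λ _ _ → mk≈ₛ λ _ → refl
    }

  module ∂ = Derivation hurwitzRing shift-isDerivation

  -- The identities for S_l have coefficients in the Hurwitz ring. This predicate traces them back
  -- to elements of `R`, so that they can be read coefficientwise as recurrences.
  IsScalar : Series → Carrier → Set ℓ
  IsScalar f a = f ≈ₛ scalar a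

  scalar-action : ∀ {f a} g k → IsScalar f a → (f ⋆ g) k ≈ a * g k
  scalar-action {f} {a} g k e = trans (at (⋆-cong e (H.refl {g})) k) (scalar-⋆ a g k)

  isScalar-+ : ∀ {f g a b} → IsScalar f a → IsScalar g b → IsScalar (f +ₛ g) (a + b)
  isScalar-+ e e′ = mk≈ₛ λ
    { zero    → +-cong (at e 0) (at e′ 0)
    ; (suc k) → trans (+-cong (at e (suc k)) (at e′ (suc k))) (+-identityˡ _)
    }

  isScalar-⋆ : ∀ {f g a b} → IsScalar f a → IsScalar g b → IsScalar (f ⋆ g) (a * b)
  isScalar-⋆ {f} {g} {a} e e′ = mk≈ₛ λ
    { zero    → *-cong (at e 0) (at e′ 0)
    ; (suc k) → trans (scalar-action g (suc k) e) (trans (*-congˡ (at e′ (suc k))) (zeroʳ a))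
    }

  isScalar-× : ∀ n → IsScalar (n H.×ᴴ 1ₛ) (n × 1#)
  isScalar-× zero    = H.refl
  isScalar-× (suc n) = isScalar-+ H.refl (isScalar-× n)

  ^-constantTerm : ∀ {f} → f 0 ≈ 1# → ∀ n → (f H.^ n) 0 ≈ 1#
  ^-constantTerm f₀ zero    = refl
  ^-constantTerm f₀ (suc n) = trans (*-cong f₀ (^-constantTerm f₀ n)) (*-identityˡ _)

  private
    ×-zeroʳ : ∀ n → n × 0# ≈ 0#
    ×-zeroʳ zero    = refl
    ×-zeroʳ (suc n) = trans (+-identityˡ _) (×-zeroʳ n)

    D : Series → Series
    D f k = suc k × f (suc k)

    *ₛ-distribʳ : ∀ h f g k → ((f +ₛ g) *ₛ h) k ≈ (f *ₛ h) k + (g *ₛ h) k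
    *ₛ-distribʳ h f g k = trans
      (sum-cong-≋ {suc k} λ i → distribʳ (h (k ℕ.∸ toℕ i)) (f (toℕ i)) (g (toℕ i)))
      (∑-distrib-+ {suc k} (λ i → f (toℕ i) * h (k ℕ.∸ toℕ i)) (λ i → g (toℕ i) * h (k ℕ.∸ toℕ i)))

    -- Induction through f = f 0 + x · `shift f`. On ordinary coefficients `shift` only drops the
    -- constant term, and the shift of `D f` is the sum of the double shift of `f` and
    -- `D (shift f)`.
    D-*ₛ : ∀ f g k → D (f *ₛ g) k ≈ (D f *ₛ g) k + (f *ₛ D g) k
    D-*ₛ f g zero = solve 4 (λ a b x y → (a :* y :+ (b :* x :+ con 0)) :+ con 0
      := ((b :+ con 0) :* x :+ con 0) :+ (a :* (y :+ con 0) :+ con 0)) refl (f 0) (f 1) (g 0) (g 1)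
    D-*ₛ f g (suc k) = begin
      suc (suc k) × (f 0 * g (2 ℕ.+ k) + (shift f *ₛ g) (suc k))
        ≈⟨ ×-distrib-+ _ _ (suc (suc k)) ⟩
      suc (suc k) × (f 0 * g (2 ℕ.+ k)) + ((shift f *ₛ g) (suc k) + suc k × (shift f *ₛ g) (suc k))
        ≈⟨ +-cong (sym (×-comm-* (suc (suc k)) (f 0) (g (2 ℕ.+ k)))) (+-congˡ (D-*ₛ (shift f) g k)) ⟩
      f 0 * D g (suc k) + ((f 1 * g (suc k) + (shift (shift f) *ₛ g) k) + ((D (shift f) *ₛ g) k + (shift f *ₛ D g) k))
        ≈⟨ solve 5 (λ a b c d e → a :+ ((b :+ c) :+ (d :+ e)) := (b :+ (c :+ d)) :+ (a :+ e)) refl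
             (f 0 * D g (suc k)) (f 1 * g (suc k)) ((shift (shift f) *ₛ g) k) ((D (shift f) *ₛ g) k) ((shift f *ₛ D g) k) ⟩
      (f 1 * g (suc k) + ((shift (shift f) *ₛ g) k + (D (shift f) *ₛ g) k)) + (f 0 * D g (suc k) + (shift f *ₛ D g) k)
        ≈⟨ +-congʳ (+-cong (*-congʳ (+-identityʳ (f 1))) (*ₛ-distribʳ g (shift (shift f)) (D (shift f)) k)) ⟨
      ((f 1 + 0#) * g (suc k) + (shift (D f) *ₛ g) k) + (f 0 * D g (suc k) + (shift f *ₛ D g) k) ∎

    shift-egfCoeff : ∀ f k → egfCoeff f (suc k) ≈ egfCoeff (D f) k
    shift-egfCoeff f k = sym (trans (×-assocˡ (f (suc k)) (k !) (suc k)) (×-congˡ {f (suc k)} (ℕ.*-comm (k !) (suc k))))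

  egfCoeff-cong : ∀ {f g} → f ≈ₛ g → egfCoeff f ≈ₛ egfCoeff g
  egfCoeff-cong e = mk≈ₛ λ k → ×-congʳ (k !) (at e k)

  egfCoeff-+ : ∀ f g → egfCoeff (f +ₛ g) ≈ₛ egfCoeff f +ₛ egfCoeff g
  egfCoeff-+ f g = mk≈ₛ λ k → ×-distrib-+ (f k) (g k) (k !)

  -- Both sides obey the Leibniz recursion, because `egfCoeff` carries the formal derivative to the
  -- shift.
  egfCoeff-* : ∀ f g → egfCoeff (f *ₛ g) ≈ₛ egfCoeff f ⋆ egfCoeff g
  egfCoeff-* f g = mk≈ₛ (go f g)
    where
    go : ∀ f g k → egfCoeff (f *ₛ g) k ≈ (egfCoeff f ⋆ egfCoeff g) k
    go f g zero    = solve 2 (λ a b → (a :* b :+ con 0) :+ con 0 := (a :+ con 0) :* (b :+ con 0)) refl (f 0) (g 0)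
    go f g (suc k) = begin
      egfCoeff (f *ₛ g) (suc k)                                  ≈⟨ shift-egfCoeff (f *ₛ g) k ⟩
      egfCoeff (D (f *ₛ g)) k                                    ≈⟨ ×-congʳ (k !) (D-*ₛ f g k) ⟩
      (k !) × ((D f *ₛ g) k + (f *ₛ D g) k)                      ≈⟨ ×-distrib-+ _ _ (k !) ⟩
      egfCoeff (D f *ₛ g) k + egfCoeff (f *ₛ D g) k              ≈⟨ +-cong (go (D f) g k) (go f (D g) k) ⟩
      (egfCoeff (D f) ⋆ egfCoeff g) k + (egfCoeff f ⋆ egfCoeff (D g)) k
        ≈⟨ +-cong (at (⋆-cong {g = egfCoeff g} (mk≈ₛ (shift-egfCoeff f)) H.refl) k)
                  (at (⋆-cong {f = egfCoeff f} H.refl (mk≈ₛ (shift-egfCoeff g))) k) ⟨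
      (shift (egfCoeff f) ⋆ egfCoeff g) k + (egfCoeff f ⋆ shift (egfCoeff g)) k ∎

  egfCoeff-scalar : ∀ a → IsScalar (egfCoeff (scalar a)) a
  egfCoeff-scalar a = mk≈ₛ λ
    { zero    → +-identityʳ a
    ; (suc k) → ×-zeroʳ (suc k !)
    }

  egfCoeff-^ : ∀ f n → egfCoeff (f ^ₛ n) ≈ₛ egfCoeff f H.^ n
  egfCoeff-^ f zero    = egfCoeff-scalar 1#
  egfCoeff-^ f (suc n) = H.trans (egfCoeff-* f (f ^ₛ n)) (H.*-congˡ {egfCoeff f} (egfCoeff-^ f n))

  egfCoeff-recip : ∀ {f} → f 0 ≈ 1# → egfCoeff f ⋆ egfCoeff (1/ f) ≈ₛ 1ₛ
  egfCoeff-recip {f} f₀ = H.trans (H.sym (egfCoeff-* f (1/ f)))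
    (H.trans (egfCoeff-cong (*-recip f f₀)) (egfCoeff-scalar 1#))

  -- Inverses in the Hurwitz ring are unique. This trades the reciprocal of a power for a power of
  -- the reciprocal, to which the derivative rules apply.
  egfCoeff-recip-^ : ∀ {f} → f 0 ≈ 1# → ∀ n → egfCoeff (1/ (f ^ₛ n)) ≈ₛ egfCoeff (1/ f) H.^ n
  egfCoeff-recip-^ {f} f₀ n = ∂.inverse-^ n (egfCoeff-recip f₀)
    (H.trans (H.*-congʳ {egfCoeff (1/ (f ^ₛ n))} (H.sym (egfCoeff-^ f n)))
             (egfCoeff-recip {f ^ₛ n} (^ₛ-constantTerm f f₀ n)))

-- The identity over any commutative ring with a cancellable t.

module DilatedHankel {c ℓ} (R : CommutativeRing c ℓ) where

  open CommutativeRing R hiding (zero)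
  open Algebra.Definitions.RawSemiring (RawRing.rawSemiring rawRing) using (_×_; _^_)
  open Algebra.Properties.Semiring.Exp semiring using (^-congˡ)
  open Algebra.Solver.Ring.NaturalCoefficients.Default commutativeSemiring using (solve; _:=_; _:+_; _:*_; con)
  open Relation.Binary.Reasoning.Setoid setoid
  open PowerSeries R
  open DeterminantProperties R
  open HankelReduction R
  open Hurwitz R

  private
    -ₛ-+ₛ : ∀ f g → (f -ₛ g) +ₛ g ≈ₛ f
    -ₛ-+ₛ f g = mk≈ₛ λ k → trans (+-assoc _ _ _) (trans (+-congˡ (-‿inverseˡ (g k))) (+-identityʳ _))

    constantTerm-recip : ∀ {f} → f 0 ≈ 1# → egfCoeff (1/ f) 0 ≈ 1#
    constantTerm-recip {f} f₀ = begin
      egfCoeff (1/ f) 0                      ≈⟨ *-identityˡ _ ⟨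
      1# * egfCoeff (1/ f) 0                 ≈⟨ *-congʳ (trans (+-identityʳ (f 0)) f₀) ⟨
      egfCoeff f 0 * egfCoeff (1/ f) 0       ≈⟨ at (egfCoeff-recip {f} f₀) 0 ⟩
      1#                                     ∎

    -- Matches differentiation, which turns (1 − x)^(−ρ) into ρ (1 − x)^(−ρ−1).
    rising-shift : ∀ ρ k → rising ρ (suc k) ≈ ρ * rising (1# + ρ) k
    rising-shift ρ zero    = solve 1 (λ r → con 1 :* (r :+ con 0) := r :* con 1) refl ρ
    rising-shift ρ (suc k) = trans (*-congʳ (rising-shift ρ k))
      (solve 3 (λ r i f → r :* f :* (r :+ (con 1 :+ i)) := r :* (f :* ((con 1 :+ r) :+ i))) refl
        ρ (k × 1#) (rising (1# + ρ) k))

    constantTerm-difference : ∀ f g → f 0 ≈ 1# → g 0 ≈ 0# → (f -ₛ g) 0 ≈ 1#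
    constantTerm-difference f g f₀ g₀ =
      trans (sym (+-identityʳ _)) (trans (+-congˡ (sym g₀)) (trans (at (-ₛ-+ₛ f g) 0) f₀))

    constantTerm-1-x : (1ₛ -ₛ x) 0 ≈ 1#
    constantTerm-1-x = constantTerm-difference 1ₛ x refl refl

  egfCoeff-1/[1-x]^ : ∀ r k → egfCoeff (1/ ((1ₛ -ₛ x) ^ₛ r)) k ≈ rising (r × 1#) k
  egfCoeff-1/[1-x]^ r k = trans (at (egfCoeff-recip-^ constantTerm-1-x r) k) (p^ r k)
    where
    h p : Series
    h = egfCoeff (1ₛ -ₛ x)
    p = egfCoeff (1/ (1ₛ -ₛ x))

    D-x : 1ₛ ≈ₛ shift (egfCoeff x)
    D-x = mk≈ₛ λ
      { zero    → sym (at (egfCoeff-scalar 1#) 0)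
      ; (suc k) → sym (at (egfCoeff-scalar 0#) (suc (suc k)))
      }

    D-h : shift h +ₛ 1ₛ ≈ₛ 0ₛ
    D-h = mk≈ₛ λ k → trans (+-congˡ (at D-x k)) (trans (sym (at (egfCoeff-+ (1ₛ -ₛ x) x) (suc k)))
      (trans (at (egfCoeff-cong (-ₛ-+ₛ 1ₛ x)) (suc k)) (trans (at (egfCoeff-scalar 1#) (suc k)) (sym (0ₛ≈0 k)))))

    -- Since p′ = p², differentiation lowers k but raises m; the induction on k therefore runs over
    -- all m at once.
    p^ : ∀ m k → (p H.^ m) k ≈ rising (m × 1#) k
    p^ m zero    = ^-constantTerm (constantTerm-recip {1ₛ -ₛ x} constantTerm-1-x) m
    p^ m (suc k) = begin
      (p H.^ m) (suc k)
        ≈⟨ at (∂.D-^ (∂.D-inverse (egfCoeff-recip constantTerm-1-x) D-h) m) k ⟩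
      ((m H.×ᴴ 1ₛ) ⋆ (p H.^ m ⋆ (p ⋆ 1ₛ))) k
        ≈⟨ scalar-action _ k (isScalar-× m) ⟩
      (m × 1#) * (p H.^ m ⋆ (p ⋆ 1ₛ)) k
        ≈⟨ *-congˡ (at (H.trans (H.*-congˡ {p H.^ m} (H.*-identityʳ p)) (H.*-comm (p H.^ m) p)) k) ⟩
      (m × 1#) * (p H.^ suc m) k
        ≈⟨ *-congˡ (p^ (suc m) k) ⟩
      (m × 1#) * rising (suc m × 1#) k
        ≈⟨ rising-shift (m × 1#) k ⟨
      rising (m × 1#) (suc k) ∎

  -- Cosine and sine enter through their initial values and their first-order system, which keeps
  -- rational coefficients out of the argument.
  Ḧ-1/[cos-t·sin]^ : (t : Carrier) → (∀ {a b} → t * a ≈ t * b → a ≈ b) →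
    (cosₛ sinₛ : Series) → cosₛ 0 ≈ 1# → sinₛ 0 ≈ 0# →
    (∀ k → egfCoeff sinₛ (suc k) ≈ egfCoeff cosₛ k) →
    (∀ k → egfCoeff cosₛ (suc k) + egfCoeff sinₛ k ≈ 0#) → ∀ r n →
    Ḧ n (1/ ((cosₛ -ₛ scalar t *ₛ sinₛ) ^ₛ r)) ≈
      (t * (t ^ 2 + 1#)) ^ (n C 2) * Ḧ n (1/ ((1ₛ -ₛ x) ^ₛ r))
  Ḧ-1/[cos-t·sin]^ t cancel cosₛ sinₛ cos₀ sin₀ D-sin D-cos r n = begin
    Ḧ n (1/ (f ^ₛ r))
      ≈⟨ det-cong n (λ i j → at 1/f^r≈S₀ (2 ℕ.* toℕ i ℕ.+ toℕ j)) ⟩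
    _
      -- The k-th Hurwitz coefficient of `S l` is its k-th derivative at 0, so the two indices
      -- change places.
      ≈⟨ det-dilated-cancelled ρ t (λ k l → S l k)
           (trans (*-identityˡ _) (^-constantTerm p₀ r))
           (λ l → trans (*-congʳ (trans (*-congʳ σ₀) (zeroˡ _))) (zeroˡ _))
           (λ k → trans (at D-S₀ k) (+-cong
             (scalar-action (S 0) k (isScalar-⋆ ρ-scalar τ-scalar))
             (scalar-action (S 1) k (isScalar-⋆ ρ-scalar υ-scalar))))
           (λ k l → let ι-scalar = isScalar-× (suc l) in trans (at (D-S l) k) (+-cong (+-cong
             (scalar-action (S l) k ι-scalar)
             (scalar-action (S (suc l)) k (isScalar-⋆ (isScalar-+ ρ-scalar (isScalar-+ ι-scalar ι-scalar)) τ-scalar)))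
             (scalar-action (S (suc (suc l))) k (isScalar-⋆ (isScalar-+ ρ-scalar ι-scalar) υ-scalar))))
           cancel n ⟩
    (t * (1# + t * t)) ^ (n C 2) * _
      ≈⟨ *-cong
           (^-congˡ (n C 2) (*-congˡ (solve 1 (λ t → con 1 :+ t :* t := t :* (t :* con 1) :+ con 1) refl t)))
           (det-cong n λ i j → sym (egfCoeff-1/[1-x]^ r (2 ℕ.* toℕ i ℕ.+ toℕ j))) ⟩
    (t * (t ^ 2 + 1#)) ^ (n C 2) * Ḧ n (1/ ((1ₛ -ₛ x) ^ₛ r)) ∎
    where
    f : Series
    f = cosₛ -ₛ scalar t *ₛ sinₛ

    ρ : Carrier
    ρ = r × 1#

    τ : Series
    τ = egfCoeff (scalar t)

    f₀ : f 0 ≈ 1#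
    f₀ = constantTerm-difference cosₛ (scalar t *ₛ sinₛ) cos₀
      (trans (+-identityʳ _) (trans (*-congˡ sin₀) (zeroʳ t)))

    p₀ : egfCoeff (1/ f) 0 ≈ 1#
    p₀ = constantTerm-recip {f} f₀

    h≈ : egfCoeff f +ₛ τ ⋆ egfCoeff sinₛ ≈ₛ egfCoeff cosₛ
    h≈ = H.trans (H.+-congˡ {egfCoeff f} (H.sym (egfCoeff-* (scalar t) sinₛ)))
      (H.trans (H.sym (egfCoeff-+ f (scalar t *ₛ sinₛ))) (egfCoeff-cong (-ₛ-+ₛ cosₛ (scalar t *ₛ sinₛ))))

    open ∂.Trigonometric {cos = egfCoeff cosₛ} {egfCoeff sinₛ} {τ} {egfCoeff f} {egfCoeff (1/ f)}
      (mk≈ₛ D-sin) (mk≈ₛ λ k → trans (D-cos k) (sym (0ₛ≈0 k)))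
      (mk≈ₛ λ k → trans (at (egfCoeff-scalar t) (suc k)) (sym (0ₛ≈0 k)))
      h≈ (egfCoeff-recip f₀) r

    1/f^r≈S₀ : egfCoeff (1/ (f ^ₛ r)) ≈ₛ S 0
    1/f^r≈S₀ = H.trans (egfCoeff-recip-^ f₀ r) (H.sym (H.*-identityˡ _))

    σ₀ : σ 0 ≈ 0#
    σ₀ = trans (*-congʳ (trans (+-identityʳ (sinₛ 0)) sin₀)) (zeroˡ _)

    ρ-scalar = isScalar-× r
    τ-scalar = egfCoeff-scalar t
    υ-scalar = isScalar-+ {1ₛ} H.refl (isScalar-⋆ τ-scalar τ-scalar)

-- Cancelling t, and the Maclaurin coefficients of cosine and sine.

module _ {c ℓ} (R : CommutativeRing c ℓ) where

  open CommutativeRing R hiding (zero)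
  open Polynomial R

  private
    coeff-⊕ : ∀ p q k → coeff (p ⊕ q) k ≈ coeff p k + coeff q k
    coeff-⊕ []      q       k       = sym (+-identityˡ _)
    coeff-⊕ (a ∷ p) []      k       = sym (+-identityʳ _)
    coeff-⊕ (a ∷ p) (b ∷ q) zero    = refl
    coeff-⊕ (a ∷ p) (b ∷ q) (suc k) = coeff-⊕ p q k

    coeff-0· : ∀ p k → coeff (0# · p) k ≈ 0#
    coeff-0· []      k       = refl
    coeff-0· (a ∷ p) zero    = zeroˡ a
    coeff-0· (a ∷ p) (suc k) = coeff-0· p k

  coeff-t⊗ : ∀ p k → coeff (variable-t ⊗ p) (suc k) ≈ coeff p k
  coeff-t⊗ p k = trans (coeff-⊕ (0# · p) (0# ∷ constant 1# ⊗ p) (suc k))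
    (trans (+-cong (coeff-0· p (suc k)) (coeff≈ (CommutativeRing.*-identityˡ polyRing p) k)) (+-identityˡ _))

  t-cancel : ∀ {p q} → variable-t ⊗ p ≋ variable-t ⊗ q → p ≋ q
  t-cancel {p} {q} e = mk≋ λ k → trans (sym (coeff-t⊗ p k)) (trans (coeff≈ e (suc k)) (coeff-t⊗ q k))

open import Defs

/-homo-+ : ∀ z w d .{{_ : NonZero d}} → (z ℚ./ d) ℚ.+ (w ℚ./ d) ≡ (z ℤ.+ w) ℚ./ d
/-homo-+ z w (suc d) = ℚ.toℚᵘ-injective (ℚᵘ.≃-trans (ℚ.toℚᵘ-homo-+ (z ℚ./ suc d) (w ℚ./ suc d))
  (ℚᵘ.≃-trans (ℚᵘ.+-cong (ℚ.toℚᵘ-fromℚᵘ (ℚᵘ.mkℚᵘ z d)) (ℚ.toℚᵘ-fromℚᵘ (ℚᵘ.mkℚᵘ w d)))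
  (ℚᵘ.≃-trans (ℚᵘ.*≡* (cross z w (ℤ.+ suc d))) (ℚᵘ.≃-sym (ℚ.toℚᵘ-fromℚᵘ (ℚᵘ.mkℚᵘ (z ℤ.+ w) d))))))
  where
  cross : ∀ z w d → (z ℤ.* d ℤ.+ w ℤ.* d) ℤ.* d ≡ (z ℤ.+ w) ℤ.* (d ℤ.* d)
  cross = ℤ-Solver.solve-∀

*-/-cancel : ∀ z d .{{_ : NonZero d}} → (ℤ.+ d ℤ.* z) ℚ./ d ≡ z ℚ./ 1
*-/-cancel z (suc d) = ℚ.fromℚᵘ-cong {ℚᵘ.mkℚᵘ (ℤ.+ suc d ℤ.* z) d} {ℚᵘ.mkℚᵘ z 0}
  (ℚᵘ.*≡* (≡.trans (ℤ.*-identityʳ _) (ℤ.*-comm (ℤ.+ suc d) z)))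

open CommutativeRing ℚ[t] using (+-congˡ; sym; trans; refl; reflexive)
open Algebra.Definitions.RawSemiring (RawRing.rawSemiring (CommutativeRing.rawRing ℚ[t])) using () renaming (_×_ to _×ᵖ_)

constant-0 : ∀ d .{{_ : NonZero d}} → constant (ℤ.0ℤ ℚ./ d) ≈ []
constant-0 d = Polynomial.mk≋ λ { zero → ℚ.0/n≡0 d ; (suc k) → ≡.refl }

×-constant : ∀ n z d .{{_ : NonZero d}} → n ×ᵖ constant (z ℚ./ d) ≈ constant ((ℤ.+ n ℤ.* z) ℚ./ d)
×-constant zero    z d = sym (constant-0 d)
×-constant (suc n) z d = trans (+-congˡ {constant (z ℚ./ d)} (×-constant n z d))
  (reflexive (≡.cong constant (≡.trans (/-homo-+ z (ℤ.+ n ℤ.* z) d)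
    (≡.cong (λ w → w ℚ./ d) (≡.sym (ℤ.suc-* (ℤ.+ n) z))))))

-- With d = k! this clears the denominators of `cosx` and `sinx`, leaving the integer sequences of
-- derivatives at 0.
d×constant[z/d] : ∀ z d .{{_ : NonZero d}} → d ×ᵖ constant (z ℚ./ d) ≈ constant (z ℚ./ 1)
d×constant[z/d] z d = trans (×-constant d z d) (reflexive (≡.cong constant (*-/-cancel z d)))

egfCoeff-cosx : ∀ k → egfCoeff cosx k ≈ constant (cos⁽ k ⁾0 ℚ./ 1)
egfCoeff-cosx k = d×constant[z/d] cos⁽ k ⁾0 (k !) {{k ℕ.!≢0}}

egfCoeff-sinx : ∀ k → egfCoeff sinx k ≈ constant (sin⁽ k ⁾0 ℚ./ 1)
egfCoeff-sinx k = d×constant[z/d] sin⁽ k ⁾0 (k !) {{k ℕ.!≢0}}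

sin⁽suc⁾ : ∀ k → sin⁽ suc k ⁾0 ≡ cos⁽ k ⁾0
sin⁽suc⁾ zero          = ≡.refl
sin⁽suc⁾ (suc zero)    = ≡.refl
sin⁽suc⁾ (suc (suc k)) = ≡.cong (ℤ.-_) (sin⁽suc⁾ k)

cos⁽suc⁾ : ∀ k → cos⁽ suc k ⁾0 ≡ ℤ.- sin⁽ k ⁾0
cos⁽suc⁾ zero          = ≡.refl
cos⁽suc⁾ (suc zero)    = ≡.refl
cos⁽suc⁾ (suc (suc k)) = ≡.cong (ℤ.-_) (cos⁽suc⁾ k)

egfCoeff-sinx-suc : ∀ k → egfCoeff sinx (suc k) ≈ egfCoeff cosx k
egfCoeff-sinx-suc k = trans (egfCoeff-sinx (suc k))
  (trans (reflexive (≡.cong (λ z → constant (z ℚ./ 1)) (sin⁽suc⁾ k))) (sym (egfCoeff-cosx k)))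

egfCoeff-cosx-suc : ∀ k → egfCoeff cosx (suc k) + egfCoeff sinx k ≈ []
egfCoeff-cosx-suc k = trans (CommutativeRing.+-cong ℚ[t] (egfCoeff-cosx (suc k)) (egfCoeff-sinx k))
  (trans (reflexive (≡.cong constant (≡.trans (/-homo-+ cos⁽ suc k ⁾0 sin⁽ k ⁾0 1)
    (≡.cong (λ z → z ℚ./ 1) (≡.trans (≡.cong (ℤ._+ sin⁽ k ⁾0) (cos⁽suc⁾ k)) (ℤ.+-inverseˡ sin⁽ k ⁾0))))))
    (constant-0 1))

sinx₀ : sinx 0 ≈ []
sinx₀ = constant-0 1

theorem16p1 : (r n : ℕ) → r ≥ 1 → n ≥ 1 →
    Ḧ n (1/ ((cosx -ₛ scalar t *ₛ sinx) ^ₛ r))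
    ≈ (t * (t ^ 2 + 1#)) ^ (n C 2) * Ḧ n (1/ ((1ₛ -ₛ x) ^ₛ r))
theorem16p1 r n _ _ = DilatedHankel.Ḧ-1/[cos-t·sin]^ ℚ[t] t (t-cancel ℚ.+-*-commutativeRing)
  cosx sinx refl sinx₀ egfCoeff-sinx-suc egfCoeff-cosx-suc r n
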